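{- Let $n\ge 4$ and $1\le p\le n-3$ be integers, let $m=\lfloor \frac{2n-p}{n-p}\rfloor$ and $t=2n-p-m(n-p)$, and let $f:[1,\infty)\to\mathbb{R}$ be a function whose restriction to $[2,\infty)$ is concave. Then for every unicyclic graph $G$ with $n$ vertices and exactly $p$ pendant vertices, $$ f(p+2) + (n-p-1) f(2) + p f(1) \le I_f(G) \le t f(m+1) + (n-p-t) f(m) + p f(1), $$ and both inequalities are attained (i.e., for each such $n,p,f$, each of the two bounds is equal to $I_f(G)$ for some unicyclic graph $G$ with $n$ vertices and $p$ pendant vertices).
   Context: All graphs are finite, connected, simple (no loops, no multiple edges) and have at least one edge. A unicyclic graph is a graph containing exactly one cycle. A vertex is pendant if it has degree $1$. For a vertex $u$ of $G$, $d_u$ denotes its degree. For a function $f:[1,\infty)\to\mathbb{R}$, $I_f(G) = \sum_{u\in V(G)} f(d_u)$. -}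

module Defs where

open import Data.Fin.Base using (Fin)
open import Data.Integer.Base as ℤ using (+_)
import Data.Integer.Properties as ℤ
open import Data.List.Base using (List; []; _∷_; _∷ʳ_; zip; length; filter; allFin)
open import Data.List.Membership.Propositional using (_∈_)
open import Data.List.Membership.Propositional.Properties
  using (∈-filter⁺; ∈-allFin; ∈-length)
open import Data.List.Relation.Unary.All using (All)
open import Data.List.Relation.Unary.Unique.Propositional using (Unique)
open import Data.Nat.Base as ℕ using (ℕ; suc; NonZero; _⊔_)
import Data.Nat.DivMod as ℕ
import Data.Nat.Properties as ℕ
open import Data.Product using (∃-syntax; _×_; _,_; proj₁; proj₂; uncurry)
open import Data.Rational.Base as ℚ using (ℚ; 0ℚ; 1ℚ; ½; ∣_∣; 1/_; Positive)
import Data.Rational.Properties as ℚ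
open import Data.Rational.Solver using (module +-*-Solver)
import Data.Rational.Unnormalised.Base as ℚᵘ
import Data.Rational.Unnormalised.Properties as ℚᵘ
open import Data.Sum using (_⊎_)
import Data.Vec.Functional as Vector
open import Function.Bundles using (Func; _⟨$⟩_; _⇔_)
open import Level using (0ℓ)
open import Relation.Binary.Bundles using (Setoid)
open import Relation.Binary.Construct.Closure.ReflexiveTransitive using (Star; ε; _◅_)
import Relation.Binary.Construct.On as On
open import Relation.Binary.Core using (Rel)
open import Relation.Binary.Definitions using (Decidable; Irreflexive; Symmetric)
open import Relation.Binary.PropositionalEquality
  using (_≡_; refl; sym; trans; cong; subst)

-- The real numbers: Cauchy sequences of rationals, with equality _≃_
-- ("the difference tends to 0") in place of a quotient.

Eventually : (ℕ → Set) → Set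
Eventually P = ∃[ N ] ∀ n → N ℕ.≤ n → P n

Cauchy : (ℕ → ℚ) → Set
Cauchy x = ∀ e → 0ℚ ℚ.< e →
  ∃[ N ] ∀ m n → N ℕ.≤ m → N ℕ.≤ n → ∣ x m ℚ.- x n ∣ ℚ.< e

record ℝ : Set where
  constructor mkℝ
  field
    seq    : ℕ → ℚ
    cauchy : Cauchy seq

open ℝ public

infix 4 _≃_ _≤ʳ_

_≃_ : Rel ℝ 0ℓ
x ≃ y = ∀ e → 0ℚ ℚ.< e → Eventually λ n → ∣ seq x n ℚ.- seq y n ∣ ℚ.< e

_≤ʳ_ : Rel ℝ 0ℓ
x ≤ʳ y = ∀ e → 0ℚ ℚ.< e → Eventually λ n → seq x n ℚ.≤ seq y n ℚ.+ e

both : ∀ {P Q : ℕ → Set} → Eventually P → Eventually Q → Eventually λ n → P n × Q n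
both (M , p) (N , q) = M ⊔ N , λ n M⊔N≤n →
  p n (ℕ.m⊔n≤o⇒m≤o M N M⊔N≤n) , q n (ℕ.m⊔n≤o⇒n≤o M N M⊔N≤n)

half>0 : ∀ e → 0ℚ ℚ.< e → 0ℚ ℚ.< ½ ℚ.* e
half>0 e 0<e = ℚ.positive⁻¹ (½ ℚ.* e) {{ℚ.pos*pos⇒pos ½ e {{ℚ.positive 0<e}}}}

half+half : ∀ e → ½ ℚ.* e ℚ.+ ½ ℚ.* e ≡ e
half+half e = trans (sym (ℚ.*-distribʳ-+ e ½ ½)) (ℚ.*-identityˡ e)

∣p+q∣<e : ∀ e {p q} → ∣ p ∣ ℚ.< ½ ℚ.* e → ∣ q ∣ ℚ.< ½ ℚ.* e → ∣ p ℚ.+ q ∣ ℚ.< e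
∣p+q∣<e e {p} {q} p< q< = ℚ.≤-<-trans (ℚ.∣p+q∣≤∣p∣+∣q∣ p q)
  (subst (∣ p ∣ ℚ.+ ∣ q ∣ ℚ.<_) (half+half e) (ℚ.+-mono-< p< q<))

∣p-q∣≡∣q-p∣ : ∀ p q → ∣ p ℚ.- q ∣ ≡ ∣ q ℚ.- p ∣
∣p-q∣≡∣q-p∣ p q = trans (sym (ℚ.∣-p∣≡∣p∣ (p ℚ.- q)))
  (cong ∣_∣ (solve 2 (λ a b → :- (a :- b) := b :- a) refl p q))
  where open +-*-Solver

telescope : ∀ p q r → (p ℚ.- q) ℚ.+ (q ℚ.- r) ≡ p ℚ.- r
telescope = solve 3 (λ a b c → (a :- b) :+ (b :- c) := a :- c) refl
  where open +-*-Solver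

Bounded : ℝ → Set
Bounded x = ∃[ B ] 0ℚ ℚ.< B × Eventually λ n → ∣ seq x n ∣ ℚ.≤ B

bounded : ∀ x → Bounded x
bounded x with cauchy x 1ℚ (ℚ.positive⁻¹ 1ℚ)
... | N , close = ∣ a ∣ ℚ.+ 1ℚ , 0<B , N , λ n N≤n → begin
    ∣ seq x n ∣                        ≡⟨ cong ∣_∣ (split (seq x n) a) ⟩
    ∣ a ℚ.+ (seq x n ℚ.- a) ∣          ≤⟨ ℚ.∣p+q∣≤∣p∣+∣q∣ a (seq x n ℚ.- a) ⟩
    ∣ a ∣ ℚ.+ ∣ seq x n ℚ.- a ∣        ≤⟨ ℚ.+-monoʳ-≤ ∣ a ∣ (ℚ.<⇒≤ (close n N N≤n ℕ.≤-refl)) ⟩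
    ∣ a ∣ ℚ.+ 1ℚ                       ∎
  where
  open ℚ.≤-Reasoning
  a = seq x N
  split : ∀ p q → p ≡ q ℚ.+ (p ℚ.- q)
  split = solve 2 (λ p q → p := q :+ (p :- q)) refl
    where open +-*-Solver
  0<B : 0ℚ ℚ.< ∣ a ∣ ℚ.+ 1ℚ
  0<B = ℚ.+-mono-≤-< (ℚ.0≤∣p∣ a) (ℚ.positive⁻¹ 1ℚ)

≃-refl : ∀ {x} → x ≃ x
≃-refl {x} e 0<e = 0 , λ n _ →
  subst (ℚ._< e) (sym (cong ∣_∣ (ℚ.+-inverseʳ (seq x n)))) 0<e

≃-sym : ∀ {x y} → x ≃ y → y ≃ x
≃-sym {x} {y} x≃y e 0<e with x≃y e 0<e
... | N , close = N , λ n N≤n →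
  subst (ℚ._< e) (∣p-q∣≡∣q-p∣ (seq x n) (seq y n)) (close n N≤n)

≃-trans : ∀ {x y z} → x ≃ y → y ≃ z → x ≃ z
≃-trans {x} {y} {z} x≃y y≃z e 0<e =
  combine (both (x≃y (½ ℚ.* e) (half>0 e 0<e)) (y≃z (½ ℚ.* e) (half>0 e 0<e)))
  where
  combine : Eventually (λ n → ∣ seq x n ℚ.- seq y n ∣ ℚ.< ½ ℚ.* e ×
                              ∣ seq y n ℚ.- seq z n ∣ ℚ.< ½ ℚ.* e) →
            Eventually (λ n → ∣ seq x n ℚ.- seq z n ∣ ℚ.< e)
  combine (N , close) = N , λ n N≤n →
    subst (λ d → ∣ d ∣ ℚ.< e) (telescope (seq x n) (seq y n) (seq z n))
      (∣p+q∣<e e {seq x n ℚ.- seq y n} {seq y n ℚ.- seq z n}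
        (proj₁ (close n N≤n)) (proj₂ (close n N≤n)))

ℝ-setoid : Setoid 0ℓ 0ℓ
ℝ-setoid = record
  { Carrier       = ℝ
  ; _≈_           = _≃_
  ; isEquivalence = record
    { refl  = λ {x} → ≃-refl {x}
    ; sym   = λ {x} {y} → ≃-sym {x} {y}
    ; trans = λ {x} {y} {z} → ≃-trans {x} {y} {z}
    }
  }

fromℚ : ℚ → ℝ
fromℚ q = mkℝ (λ _ → q) λ e 0<e → 0 , λ _ _ _ _ →
  subst (ℚ._< e) (sym (cong ∣_∣ (ℚ.+-inverseʳ q))) 0<e

fromℕ : ℕ → ℝ
fromℕ k = fromℚ (+ k ℚ./ 1)

0ℝ 1ℝ : ℝ
0ℝ = fromℕ 0
1ℝ = fromℕ 1

infixl 6 _+ʳ_ _-ʳ_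
infixl 7 _*ʳ_

_+ʳ_ : ℝ → ℝ → ℝ
x +ʳ y = mkℝ (λ n → seq x n ℚ.+ seq y n) isCauchy
  where
  regroup : ∀ a b c d → (a ℚ.- c) ℚ.+ (b ℚ.- d) ≡ (a ℚ.+ b) ℚ.- (c ℚ.+ d)
  regroup = solve 4 (λ a b c d → (a :- c) :+ (b :- d) := (a :+ b) :- (c :+ d)) refl
    where open +-*-Solver

  isCauchy : Cauchy (λ n → seq x n ℚ.+ seq y n)
  isCauchy e 0<e
    with cauchy x (½ ℚ.* e) (half>0 e 0<e) | cauchy y (½ ℚ.* e) (half>0 e 0<e)
  ... | M , cx | N , cy = M ⊔ N , λ m n m≥ n≥ →
    subst (λ d → ∣ d ∣ ℚ.< e) (regroup (seq x m) (seq y m) (seq x n) (seq y n))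
      (∣p+q∣<e e
        (cx m n (ℕ.m⊔n≤o⇒m≤o M N m≥) (ℕ.m⊔n≤o⇒m≤o M N n≥))
        (cy m n (ℕ.m⊔n≤o⇒n≤o M N m≥) (ℕ.m⊔n≤o⇒n≤o M N n≥)))

-ʳ_ : ℝ → ℝ
-ʳ x = mkℝ (λ n → ℚ.- seq x n) isCauchy
  where
  isCauchy : Cauchy (λ n → ℚ.- seq x n)
  isCauchy e 0<e with cauchy x e 0<e
  ... | N , cx = N , λ m n m≥ n≥ →
    subst (λ d → ∣ d ∣ ℚ.< e) (flip (seq x n) (seq x m)) (cx n m n≥ m≥)
    where
    flip : ∀ a b → a ℚ.- b ≡ (ℚ.- b) ℚ.- (ℚ.- a)
    flip = solve 2 (λ a b → a :- b := (:- b) :- (:- a)) refl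
      where open +-*-Solver

_-ʳ_ : ℝ → ℝ → ℝ
x -ʳ y = x +ʳ (-ʳ y)

_*ʳ_ : ℝ → ℝ → ℝ
x *ʳ y = mkℝ (λ n → seq x n ℚ.* seq y n) isCauchy
  where
  regroup : ∀ a b c d → a ℚ.* (b ℚ.- d) ℚ.+ d ℚ.* (a ℚ.- c) ≡ a ℚ.* b ℚ.- c ℚ.* d
  regroup = solve 4 (λ a b c d → a :* (b :- d) :+ d :* (a :- c) := a :* b :- c :* d) refl
    where open +-*-Solver

  ∣p*q∣<B*δ : ∀ p q {B δ} → 0ℚ ℚ.< B → ∣ p ∣ ℚ.≤ B → ∣ q ∣ ℚ.< δ → ∣ p ℚ.* q ∣ ℚ.< B ℚ.* δ
  ∣p*q∣<B*δ p q {B} {δ} 0<B p≤B q<δ = begin-strict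
    ∣ p ℚ.* q ∣      ≡⟨ ℚ.∣p*q∣≡∣p∣*∣q∣ p q ⟩
    ∣ p ∣ ℚ.* ∣ q ∣  ≤⟨ ℚ.*-monoʳ-≤-nonNeg ∣ q ∣ {{ℚ.nonNegative (ℚ.0≤∣p∣ q)}} p≤B ⟩
    B ℚ.* ∣ q ∣      <⟨ ℚ.*-monoʳ-<-pos B {{ℚ.positive 0<B}} q<δ ⟩
    B ℚ.* δ          ∎
    where open ℚ.≤-Reasoning

  fromBounds : Bounded x → Bounded y → Cauchy (λ n → seq x n ℚ.* seq y n)
  fromBounds (B , 0<B , M , x≤B) (C , 0<C , N , y≤C) e 0<e =
    go (cauchy x δ 0<δ) (cauchy y δ 0<δ)
    where
    instance
      e-pos : Positive e
      e-pos = ℚ.positive 0<e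
      B+C-pos : Positive (B ℚ.+ C)
      B+C-pos = ℚ.positive (ℚ.+-mono-< 0<B 0<C)
      B+C-nonZero : ℚ.NonZero (B ℚ.+ C)
      B+C-nonZero = ℚ.pos⇒nonZero (B ℚ.+ C)
    δ : ℚ
    δ = 1/ (B ℚ.+ C) ℚ.* e
    0<δ : 0ℚ ℚ.< δ
    0<δ = ℚ.positive⁻¹ δ {{ℚ.pos*pos⇒pos (1/ (B ℚ.+ C)) {{ℚ.1/pos⇒pos (B ℚ.+ C)}} e}}
    Bδ+Cδ≡e : B ℚ.* δ ℚ.+ C ℚ.* δ ≡ e
    Bδ+Cδ≡e = trans (sym (ℚ.*-distribʳ-+ δ B C))
      (trans (sym (ℚ.*-assoc (B ℚ.+ C) (1/ (B ℚ.+ C)) e))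
      (trans (cong (ℚ._* e) (ℚ.*-inverseʳ (B ℚ.+ C))) (ℚ.*-identityˡ e)))
    estimate : ∀ a b c d → ∣ a ∣ ℚ.≤ B → ∣ d ∣ ℚ.≤ C →
      ∣ a ℚ.- c ∣ ℚ.< δ → ∣ b ℚ.- d ∣ ℚ.< δ → ∣ a ℚ.* b ℚ.- c ℚ.* d ∣ ℚ.< e
    estimate a b c d a≤B d≤C a-c<δ b-d<δ = begin-strict
      ∣ a ℚ.* b ℚ.- c ℚ.* d ∣                            ≡⟨ cong ∣_∣ (sym (regroup a b c d)) ⟩
      ∣ a ℚ.* (b ℚ.- d) ℚ.+ d ℚ.* (a ℚ.- c) ∣            ≤⟨ ℚ.∣p+q∣≤∣p∣+∣q∣ (a ℚ.* (b ℚ.- d)) (d ℚ.* (a ℚ.- c)) ⟩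
      ∣ a ℚ.* (b ℚ.- d) ∣ ℚ.+ ∣ d ℚ.* (a ℚ.- c) ∣        <⟨ ℚ.+-mono-<
                                                              (∣p*q∣<B*δ a (b ℚ.- d) 0<B a≤B b-d<δ)
                                                              (∣p*q∣<B*δ d (a ℚ.- c) 0<C d≤C a-c<δ) ⟩
      B ℚ.* δ ℚ.+ C ℚ.* δ                                ≡⟨ Bδ+Cδ≡e ⟩
      e                                                  ∎
      where open ℚ.≤-Reasoning
    go : ∃[ K ] (∀ m n → K ℕ.≤ m → K ℕ.≤ n → ∣ seq x m ℚ.- seq x n ∣ ℚ.< δ) →
         ∃[ L ] (∀ m n → L ℕ.≤ m → L ℕ.≤ n → ∣ seq y m ℚ.- seq y n ∣ ℚ.< δ) →
         ∃[ R ] (∀ m n → R ℕ.≤ m → R ℕ.≤ n →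
           ∣ seq x m ℚ.* seq y m ℚ.- seq x n ℚ.* seq y n ∣ ℚ.< e)
    go (K , cx) (L , cy) = (M ⊔ N) ⊔ (K ⊔ L) , λ m n m≥ n≥ →
      let M⊔N≤ : ∀ {k} → (M ⊔ N) ⊔ (K ⊔ L) ℕ.≤ k → M ⊔ N ℕ.≤ k
          M⊔N≤ = ℕ.m⊔n≤o⇒m≤o (M ⊔ N) (K ⊔ L)
          K⊔L≤ : ∀ {k} → (M ⊔ N) ⊔ (K ⊔ L) ℕ.≤ k → K ⊔ L ℕ.≤ k
          K⊔L≤ = ℕ.m⊔n≤o⇒n≤o (M ⊔ N) (K ⊔ L)
      in estimate (seq x m) (seq y m) (seq x n) (seq y n)
           (x≤B m (ℕ.m⊔n≤o⇒m≤o M N (M⊔N≤ m≥)))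
           (y≤C n (ℕ.m⊔n≤o⇒n≤o M N (M⊔N≤ n≥)))
           (cx m n (ℕ.m⊔n≤o⇒m≤o K L (K⊔L≤ m≥)) (ℕ.m⊔n≤o⇒m≤o K L (K⊔L≤ n≥)))
           (cy m n (ℕ.m⊔n≤o⇒n≤o K L (K⊔L≤ m≥)) (ℕ.m⊔n≤o⇒n≤o K L (K⊔L≤ n≥)))

  isCauchy : Cauchy (λ n → seq x n ℚ.* seq y n)
  isCauchy = fromBounds (bounded x) (bounded y)

-- ⟩ stands for the closing parenthesis of a half-open interval, which Agda
-- does not allow in names.  The equality ignores the proof component.
[1,∞⟩ : Setoid 0ℓ 0ℓ
[1,∞⟩ = On.setoid {B = ∃[ x ] 1ℝ ≤ʳ x} ℝ-setoid proj₁

[1,∞⟩⟶ℝ : Set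
[1,∞⟩⟶ℝ = Func [1,∞⟩ ℝ-setoid

1≤fromℕ : ∀ k .{{_ : NonZero k}} → 1ℝ ≤ʳ fromℕ k
1≤fromℕ k@(suc k-1) e 0<e = 0 , λ _ _ → ℚ.≤-trans 1≤k
  (subst (ℚ._≤ + k ℚ./ 1 ℚ.+ e) (ℚ.+-identityʳ (+ k ℚ./ 1))
    (ℚ.+-monoʳ-≤ (+ k ℚ./ 1) (ℚ.<⇒≤ 0<e)))
  where
  1≤k : 1ℚ ℚ.≤ + k ℚ./ 1
  1≤k = ℚ.toℚᵘ-cancel-≤ (ℚᵘ.≤-trans
    (ℚᵘ.*≤* (ℤ.*-monoʳ-≤-nonNeg (+ 1) (ℤ.+≤+ (ℕ.s≤s (ℕ.z≤n {k-1})))))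
    (ℚᵘ.≤-reflexive (ℚᵘ.≃-sym (ℚ.toℚᵘ-fromℚᵘ (ℚᵘ.mkℚᵘ (+ k) 0)))))

infixl 8 _at_

_at_ : [1,∞⟩⟶ℝ → (k : ℕ) .{{_ : NonZero k}} → ℝ
f at k = f ⟨$⟩ (fromℕ k , 1≤fromℕ k)

-- The point z stands for s x + (1 - s) y; naming it avoids carrying a
-- proof that this convex combination again lies in [1,∞).
ConcaveOn[2,∞⟩ : [1,∞⟩⟶ℝ → Set
ConcaveOn[2,∞⟩ f =
  ∀ (x y z : Setoid.Carrier [1,∞⟩) (s : ℝ) →
  fromℕ 2 ≤ʳ proj₁ x → fromℕ 2 ≤ʳ proj₁ y →
  0ℝ ≤ʳ s → s ≤ʳ 1ℝ →
  proj₁ z ≃ s *ʳ proj₁ x +ʳ (1ℝ -ʳ s) *ʳ proj₁ y →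
  s *ʳ (f ⟨$⟩ x) +ʳ (1ℝ -ʳ s) *ʳ (f ⟨$⟩ y) ≤ʳ f ⟨$⟩ z

-- Finite connected simple graphs with at least one edge.
record Graph (n : ℕ) : Set₁ where
  infix 4 _~_ _~?_
  field
    _~_       : Rel (Fin n) 0ℓ
    _~?_      : Decidable _~_
    irrefl    : Irreflexive _≡_ _~_
    symmetric : Symmetric _~_
    connected : ∀ u v → Star _~_ u v
    hasEdge   : ∃[ u ] ∃[ v ] u ~ v

  degree : Fin n → ℕ
  degree u = length (filter (u ~?_) (allFin n))

  neighbour : ∀ u → ∃[ v ] u ~ v
  neighbour u with hasEdge
  ... | a , b , a~b with connected u a
  ...   | ε       = b , a~b
  ...   | u~v ◅ _ = _ , u~v

  degree-nonZero : ∀ u → NonZero (degree u)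
  degree-nonZero u with neighbour u
  ... | v , u~v = ℕ.>-nonZero (∈-length (∈-filter⁺ (u ~?_) (∈-allFin v) u~v))

  pendantCount : ℕ
  pendantCount = length (filter (λ u → degree u ℕ.≟ 1) (allFin n))

-- (v₀,v₁), (v₁,v₂), …, (vₖ,v₀)
cyclicPairs : ∀ {A : Set} → List A → List (A × A)
cyclicPairs []       = []
cyclicPairs (v ∷ vs) = zip (v ∷ vs) (vs ∷ʳ v)

module _ {n : ℕ} (G : Graph n) where
  open Graph G

  -- A cycle together with a starting vertex and a direction of traversal.
  record Cycle : Set where
    field
      vertices : List (Fin n)
      long     : 3 ℕ.≤ length vertices
      distinct : Unique vertices
      closed   : All (uncurry _~_) (cyclicPairs vertices)

    Traverses : Rel (Fin n) 0ℓ
    Traverses u v = (u , v) ∈ cyclicPairs vertices ⊎ (v , u) ∈ cyclicPairs vertices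

  -- Traversals with the same edge set are the same cycle of the graph.
  SameCycle : Rel Cycle 0ℓ
  SameCycle C D = ∀ u v → Cycle.Traverses C u v ⇔ Cycle.Traverses D u v

  Unicyclic : Set
  Unicyclic = ∃[ C ] ∀ D → SameCycle C D

  I : [1,∞⟩⟶ℝ → ℝ
  I f = Vector.foldr _+ʳ_ 0ℝ λ u → (f at degree u) {{degree-nonZero u}}

n∸p-nonZero : ∀ {n p} → 4 ℕ.≤ n → p ℕ.≤ n ℕ.∸ 3 → NonZero (n ℕ.∸ p)
n∸p-nonZero {suc (suc (suc k))} {p} (ℕ.s≤s (ℕ.s≤s (ℕ.s≤s _))) p≤n∸3 =
  ℕ.>-nonZero (ℕ.m<n⇒0<n∸m (ℕ.≤-<-trans p≤n∸3 (ℕ.s≤s (ℕ.m≤n+m k 2))))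

quotient-nonZero : ∀ n p .{{_ : NonZero (n ℕ.∸ p)}} →
  NonZero ((2 ℕ.* n ℕ.∸ p) ℕ./ (n ℕ.∸ p))
quotient-nonZero n p =
  ℕ.>-nonZero (ℕ.m≥n⇒m/n>0 (ℕ.∸-monoˡ-≤ p (ℕ.m≤m+n n (n ℕ.+ 0))))

{-# OPTIONS --safe #-}

-- A connected unicyclic graph can be oriented so that every vertex has exactly
-- one outgoing edge, with head s u: around the cycle, and towards the cycle
-- elsewhere.  Hence d_u = 1 + |s⁻¹(u)|, and the degrees sum to 2n.  If p vertices
-- are pendant, the other n - p have degrees ≥ 2 with excesses d_u - 2 summing
-- to p.  A sum of concave values with prescribed excesses is smallest when one
-- vertex takes the whole excess (merging a and b into a + b and 0 decreases it),
-- and it is bounded above by the line through (m, f(m)) and (m+1, f(m+1)), which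
-- dominates f at all integers ≥ 2.  Both bounds are attained by a cycle of length
-- n - p with pendant vertices attached to it.

module Submission where

open import Defs
open import Data.Nat using (ℕ; suc; NonZero; _+_; _*_; _∸_; _/_; _≤_)
open import Data.Product using (∃-syntax; _×_)
open import Relation.Binary.PropositionalEquality using (_≡_)

open import Algebra.Bundles using (CommutativeMonoid)
import Algebra.Properties.CommutativeMonoid.Sum as CMSum
import Algebra.Properties.Semiring.Sum as SemiringSum
open import Data.Bool.Base using (true; false; if_then_else_)
open import Data.Fin.Base using (Fin; zero; suc; toℕ; inject₁; splitAt; join; _↑ˡ_; _↑ʳ_)
  renaming (fromℕ to lastFin)
open import Data.Fin.Induction using (<-weakInduction; >-weakInduction)
import Data.Fin.Properties as Fin
import Data.Integer.Base as ℤ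
import Data.Integer.Properties as ℤ
open import Data.List.Base using (List; []; _∷_; _∷ʳ_; zip; length; filter; tabulate)
open import Data.List.Membership.DecPropositional using () renaming (_∈?_ to member?)
open import Data.List.Membership.Propositional using (_∈_; _∉_)
open import Data.List.Membership.Propositional.Properties using (∈-++⁺ʳ; ∈-++⁺ˡ)
open import Data.List.Properties using (length-tabulate)
open import Data.List.Relation.Unary.All as All using (All; []; _∷_)
open import Data.List.Relation.Unary.All.Properties using (All¬⇒¬Any; ¬Any⇒All¬)
open import Data.List.Relation.Unary.AllPairs using ([]; _∷_)
open import Data.List.Relation.Unary.Any using (here; there)
open import Data.List.Relation.Unary.Unique.Propositional using (Unique)
open import Data.List.Relation.Unary.Unique.Propositional.Properties using (tabulate⁺)
open import Data.Nat
  using (zero; pred; z≤n; s≤s; _<_; _%_; _≟_; _≤′_; ≤′-refl; ≤′-step; _≤‴_; ≤‴-refl; ≤‴-step)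
open import Data.Nat.DivMod using (m*n/n≡m; /-monoˡ-≤; m%n≡m∸m/n*n; m%n≤n; m≡m%n+[m/n]*n)
open import Data.Nat.Induction using (<-wellFounded)
open import Data.Nat.Properties
open import Data.Product using (∃; _,_; proj₁; proj₂; map; map₂; uncurry)
import Data.Rational.Base as ℚ
import Data.Rational.Properties as ℚ
open import Data.Rational.Solver using (module +-*-Solver)
import Data.Rational.Unnormalised.Base as ℚᵘ
import Data.Rational.Unnormalised.Properties as ℚᵘ
open import Data.Sum as Sum using (_⊎_; inj₁; inj₂; [_,_]′)
open import Function using (_∘_; const)
open import Function.Bundles using (Equivalence; mk⇔)
open import Induction.WellFounded using (Acc; acc)
open import Level using (0ℓ)
open import Relation.Binary.Construct.Closure.ReflexiveTransitive as Star using (Star; ε; _◅_; _◅◅_)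
open import Relation.Binary.Core using (Rel)
open import Relation.Binary.Definitions using (Decidable; DecidableEquality; Symmetric)
open import Relation.Binary.PropositionalEquality using (_≢_; refl; sym; trans; cong; cong₂; subst; module ≡-Reasoning)
open import Relation.Nullary using (Dec; does; yes; no; ¬_; contradiction; _⊎-dec_; _×-dec_)
import Relation.Unary as Unary

-- The reals as an ordered group

-- That the degrees sum to 2n amounts to the graph having exactly n edges. No edges are counted and
-- no leaves deleted: `s` is built from the distance to the cycle, and uniqueness of the cycle is
-- used only to show that no edge escapes `s`. The degree sum is then the fact that the fibres of
-- `s` partition the vertices. The constants come from k = n - p, the number of non-pendant
-- vertices. Since 2n - p = 2k + p, division by k gives p = (m - 2)k + t: the excess p, spread
-- evenly over k vertices, gives each m - 2, with t units left over. The hypothesis p ≤ n - 3 says k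
-- ≥ 3, which lets k vertices form a cycle. Concavity says nothing about f(1), so the pendant terms
-- have to be separated before any inequality is applied to the others. Inequalities between reals
-- hold only eventually and up to e. They are therefore added up, and common terms are cancelled by
-- a ring identity valid at every index of the sequences.

infix 4 _≐_

-- Finer than _≃_, but ring identities hold for it because they hold in ℚ at every index.
_≐_ : Rel ℝ 0ℓ
x ≐ y = ∀ n → seq x n ≡ seq y n

≐⇒≃ : ∀ {x y} → x ≐ y → x ≃ y
≐⇒≃ {x} {y} x≐y e 0<e = 0 , λ n _ →
  subst (λ q → ℚ.∣ q ∣ ℚ.< e)
    (sym (trans (cong (ℚ._- seq y n) (x≐y n)) (ℚ.+-inverseʳ (seq y n)))) 0<e

ℝ-+-commutativeMonoid : CommutativeMonoid 0ℓ 0ℓ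
ℝ-+-commutativeMonoid = record
  { Carrier = ℝ
  ; _≈_ = _≐_
  ; _∙_ = _+ʳ_
  ; ε = 0ℝ
  ; isCommutativeMonoid = record
    { isMonoid = record
      { isSemigroup = record
        { isMagma = record
          { isEquivalence = record
            { refl = λ _ → refl
            ; sym = λ p n → sym (p n)
            ; trans = λ p q n → trans (p n) (q n)
            }
          ; ∙-cong = λ p q n → cong₂ ℚ._+_ (p n) (q n)
          }
        ; assoc = λ x y z n → ℚ.+-assoc (seq x n) (seq y n) (seq z n)
        }
      ; identity = (λ x n → ℚ.+-identityˡ (seq x n)) , λ x n → ℚ.+-identityʳ (seq x n)
      }
    ; comm = λ x y n → ℚ.+-comm (seq x n) (seq y n)
    }
  }

module Σʳ = CMSum ℝ-+-commutativeMonoid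
module Σⁿ = SemiringSum +-*-semiring

fromℕ-+ : ∀ a b → ℤ.+ (a + b) ℚ./ 1 ≡ (ℤ.+ a ℚ./ 1) ℚ.+ (ℤ.+ b ℚ./ 1)
fromℕ-+ a b = ℚ.toℚᵘ-injective (begin
  ℚ.toℚᵘ (ℤ.+ (a + b) ℚ./ 1)                        ≈⟨ ℚ.toℚᵘ-fromℚᵘ (ℚᵘ.mkℚᵘ (ℤ.+ (a + b)) 0) ⟩
  ℚᵘ.mkℚᵘ (ℤ.+ (a + b)) 0                           ≈⟨ ℚᵘ.*≡* (cong (ℤ._* ℤ.+ 1) (sym (cong₂ ℤ._+_ (ℤ.*-identityʳ (ℤ.+ a)) (ℤ.*-identityʳ (ℤ.+ b))))) ⟩
  ℚᵘ.mkℚᵘ (ℤ.+ a) 0 ℚᵘ.+ ℚᵘ.mkℚᵘ (ℤ.+ b) 0          ≈⟨ ℚᵘ.+-cong (ℚ.toℚᵘ-fromℚᵘ (ℚᵘ.mkℚᵘ (ℤ.+ a) 0)) (ℚ.toℚᵘ-fromℚᵘ (ℚᵘ.mkℚᵘ (ℤ.+ b) 0)) ⟨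
  ℚ.toℚᵘ (ℤ.+ a ℚ./ 1) ℚᵘ.+ ℚ.toℚᵘ (ℤ.+ b ℚ./ 1)    ≈⟨ ℚ.toℚᵘ-homo-+ (ℤ.+ a ℚ./ 1) (ℤ.+ b ℚ./ 1) ⟨
  ℚ.toℚᵘ ((ℤ.+ a ℚ./ 1) ℚ.+ (ℤ.+ b ℚ./ 1))          ∎)
  where open ℚᵘ.≃-Reasoning

-- The second hypothesis says b - a = y - x.
≤ʳ-by-≐ : ∀ {x y a b} → x ≤ʳ y → a +ʳ y ≐ x +ʳ b → a ≤ʳ b
≤ʳ-by-≐ {x} {y} {a} {b} x≤y a+y≐x+b e 0<e with x≤y e 0<e
... | N , x≤y+e = N , λ n N≤n → begin
  seq a n                                        ≡⟨ solve 2 (λ a y → a := (a :+ y) :- y) refl (seq a n) (seq y n) ⟩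
  (seq a n ℚ.+ seq y n) ℚ.- seq y n              ≡⟨ cong (ℚ._- seq y n) (a+y≐x+b n) ⟩
  (seq x n ℚ.+ seq b n) ℚ.- seq y n              ≤⟨ ℚ.+-monoˡ-≤ (ℚ.- seq y n) (ℚ.+-monoˡ-≤ (seq b n) (x≤y+e n N≤n)) ⟩
  (seq y n ℚ.+ e ℚ.+ seq b n) ℚ.- seq y n        ≡⟨ solve 3 (λ y e b → ((y :+ e) :+ b) :- y := b :+ e) refl (seq y n) e (seq b n) ⟩
  seq b n ℚ.+ e                                  ∎
  where
  open ℚ.≤-Reasoning
  open +-*-Solver

≤ʳ-refl : ∀ {x} → x ≤ʳ x
≤ʳ-refl {x} e 0<e = 0 , λ n _ → begin
  seq x n              ≡⟨ ℚ.+-identityʳ (seq x n) ⟨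
  seq x n ℚ.+ ℚ.0ℚ     ≤⟨ ℚ.+-monoʳ-≤ (seq x n) (ℚ.<⇒≤ 0<e) ⟩
  seq x n ℚ.+ e        ∎
  where open ℚ.≤-Reasoning

≐⇒≤ʳ : ∀ {x y} → x ≐ y → x ≤ʳ y
≐⇒≤ʳ {x} {y} x≐y = ≤ʳ-by-≐ {x} {x} {x} {y} (≤ʳ-refl {x}) λ n → cong (seq x n ℚ.+_) (x≐y n)

+ʳ-mono-≤ʳ : ∀ {a b x y} → a ≤ʳ b → x ≤ʳ y → a +ʳ x ≤ʳ b +ʳ y
+ʳ-mono-≤ʳ {a} {b} {x} {y} a≤b x≤y e 0<e
  with both (a≤b (ℚ.½ ℚ.* e) (half>0 e 0<e)) (x≤y (ℚ.½ ℚ.* e) (half>0 e 0<e))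
... | N , close = N , λ n N≤n → let a≤b+ , x≤y+ = close n N≤n in begin
  seq a n ℚ.+ seq x n                                          ≤⟨ ℚ.+-mono-≤ a≤b+ x≤y+ ⟩
  (seq b n ℚ.+ ℚ.½ ℚ.* e) ℚ.+ (seq y n ℚ.+ ℚ.½ ℚ.* e)          ≡⟨ solve 3 (λ b y d → (b :+ d) :+ (y :+ d) := (b :+ y) :+ (d :+ d)) refl (seq b n) (seq y n) (ℚ.½ ℚ.* e) ⟩
  (seq b n ℚ.+ seq y n) ℚ.+ (ℚ.½ ℚ.* e ℚ.+ ℚ.½ ℚ.* e)          ≡⟨ cong (seq b n ℚ.+ seq y n ℚ.+_) (half+half e) ⟩
  (seq b n ℚ.+ seq y n) ℚ.+ e                                  ∎
  where
  open ℚ.≤-Reasoning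
  open +-*-Solver

-- Finite sums of reals and of naturals

Σ-mono-≤ʳ : ∀ {n} (x y : Fin n → ℝ) → (∀ u → x u ≤ʳ y u) → Σʳ.sum x ≤ʳ Σʳ.sum y
Σ-mono-≤ʳ {zero}  x y x≤y = ≤ʳ-refl {0ℝ}
Σ-mono-≤ʳ {suc n} x y x≤y = +ʳ-mono-≤ʳ {x zero} {y zero} {Σʳ.sum (x ∘ suc)} {Σʳ.sum (y ∘ suc)}
  (x≤y zero) (Σ-mono-≤ʳ (x ∘ suc) (y ∘ suc) (x≤y ∘ suc))

Σ-fromℕ-* : ∀ {n} (c : Fin n → ℕ) x → Σʳ.sum (λ u → fromℕ (c u) *ʳ x) ≐ fromℕ (Σⁿ.sum c) *ʳ x
Σ-fromℕ-* {zero}  c x k = sym (ℚ.*-zeroˡ (seq x k))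
Σ-fromℕ-* {suc n} c x k = begin
  C ℚ.* X ℚ.+ seq (Σʳ.sum (λ u → fromℕ (c (suc u)) *ʳ x)) k  ≡⟨ cong (C ℚ.* X ℚ.+_) (Σ-fromℕ-* (c ∘ suc) x k) ⟩
  C ℚ.* X ℚ.+ (ℤ.+ Σⁿ.sum (c ∘ suc) ℚ./ 1) ℚ.* X                ≡⟨ ℚ.*-distribʳ-+ X C _ ⟨
  (C ℚ.+ (ℤ.+ Σⁿ.sum (c ∘ suc) ℚ./ 1)) ℚ.* X                    ≡⟨ cong (ℚ._* X) (fromℕ-+ (c zero) (Σⁿ.sum (c ∘ suc))) ⟨
  (ℤ.+ (c zero + Σⁿ.sum (c ∘ suc)) ℚ./ 1) ℚ.* X                 ∎
  where
  open ≡-Reasoning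
  C = ℤ.+ c zero ℚ./ 1
  X = seq x k

Σ-const : ∀ n c → Σⁿ.sum {n} (λ _ → c) ≡ n * c
Σ-const zero    c = refl
Σ-const (suc n) c = cong (c +_) (Σ-const n c)

Σ-const-1 : ∀ n → Σⁿ.sum {n} (λ _ → 1) ≡ n
Σ-const-1 n = trans (Σ-const n 1) (*-identityʳ n)

Σʳ-const : ∀ n x → Σʳ.sum {n} (λ _ → x) ≐ fromℕ n *ʳ x
Σʳ-const zero    x k = sym (ℚ.*-zeroˡ (seq x k))
Σʳ-const (suc n) x k = begin
  X ℚ.+ seq (Σʳ.sum {n} (λ _ → x)) k   ≡⟨ cong (X ℚ.+_) (Σʳ-const n x k) ⟩
  X ℚ.+ N ℚ.* X                        ≡⟨ cong (ℚ._+ N ℚ.* X) (ℚ.*-identityˡ X) ⟨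
  ℚ.1ℚ ℚ.* X ℚ.+ N ℚ.* X               ≡⟨ ℚ.*-distribʳ-+ X ℚ.1ℚ N ⟨
  (ℚ.1ℚ ℚ.+ N) ℚ.* X                   ≡⟨ cong (ℚ._* X) (fromℕ-+ 1 n) ⟨
  (ℤ.+ suc n ℚ./ 1) ℚ.* X              ∎
  where
  open ≡-Reasoning
  X = seq x k
  N = ℤ.+ n ℚ./ 1

module _ {c ℓ} (M : CommutativeMonoid c ℓ) where
  open CommutativeMonoid M
  open CMSum M using (sum)

  sum-splitAt : ∀ m {n} (x : Fin (m + n) → Carrier) → sum x ≈ sum (x ∘ (_↑ˡ n)) ∙ sum (x ∘ (m ↑ʳ_))
  sum-splitAt zero    x = CommutativeMonoid.sym M (identityˡ _)
  sum-splitAt (suc m) x = CommutativeMonoid.trans M (∙-congˡ (sum-splitAt m (x ∘ suc))) (CommutativeMonoid.sym M (assoc _ _ _))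

-- Concave sequences

Concave : (ℕ → ℝ) → Set
Concave g = ∀ k → g k +ʳ g (2 + k) ≤ʳ g (1 + k) +ʳ g (1 + k)

module ConcaveSequence {g : ℕ → ℝ} (concave : Concave g) where
  open +-*-Solver

  -- Adds up the second-difference inequalities between `a` and `b`. The slopes at `a` and `b` are
  -- compared with their negative terms moved across.
  slopes-decrease : ∀ {a b} → a ≤′ b → g a +ʳ g (suc b) ≤ʳ g (suc a) +ʳ g b
  slopes-decrease {a} ≤′-refl = ≐⇒≤ʳ {g a +ʳ g (suc a)} {g (suc a) +ʳ g a}
    λ n → ℚ.+-comm (seq (g a) n) (seq (g (suc a)) n)
  slopes-decrease {a} (≤′-step {b} a≤b) =
    ≤ʳ-by-≐ {g a +ʳ g (suc b) +ʳ (g b +ʳ g (2 + b))} {g (suc a) +ʳ g b +ʳ (g (suc b) +ʳ g (suc b))}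
            {g a +ʳ g (2 + b)} {g (suc a) +ʳ g (suc b)}
      (+ʳ-mono-≤ʳ {g a +ʳ g (suc b)} {g (suc a) +ʳ g b} {g b +ʳ g (2 + b)} {g (suc b) +ʳ g (suc b)}
        (slopes-decrease a≤b) (concave b))
      λ n → solve 5 (λ a a′ b b′ b″ → (a :+ b″) :+ (a′ :+ b :+ (b′ :+ b′)) := (a :+ b′ :+ (b :+ b″)) :+ (a′ :+ b′)) refl
        (seq (g a) n) (seq (g (suc a)) n) (seq (g b) n) (seq (g (suc b)) n) (seq (g (2 + b)) n)

  -- Raising `a` by one adds the slope at `a + b` on the left and the slope at `a` on the right; the
  -- former lies further out, so it is the smaller.
  merge : ∀ a b → g (a + b) +ʳ g 0 ≤ʳ g a +ʳ g b
  merge zero    b = ≐⇒≤ʳ {g b +ʳ g 0} {g 0 +ʳ g b} λ n → ℚ.+-comm (seq (g b) n) (seq (g 0) n)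
  merge (suc a) b =
    ≤ʳ-by-≐ {g (a + b) +ʳ g 0 +ʳ (g a +ʳ g (suc (a + b)))} {g a +ʳ g b +ʳ (g (suc a) +ʳ g (a + b))}
            {g (suc (a + b)) +ʳ g 0} {g (suc a) +ʳ g b}
      (+ʳ-mono-≤ʳ {g (a + b) +ʳ g 0} {g a +ʳ g b} {g a +ʳ g (suc (a + b))} {g (suc a) +ʳ g (a + b)}
        (merge a b) (slopes-decrease (≤⇒≤′ (m≤m+n a b))))
      λ n → solve 6 (λ a a′ b c c′ o → (c′ :+ o) :+ (a :+ b :+ (a′ :+ c)) := (c :+ o :+ (a :+ c′)) :+ (a′ :+ b)) refl
        (seq (g a) n) (seq (g (suc a)) n) (seq (g b) n) (seq (g (a + b)) n) (seq (g (suc (a + b))) n) (seq (g 0) n)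

  -- The spare `g 0` on the right stands for n - 1 copies on the left, so that the empty family is a
  -- valid start. Each step merges the head with the already merged tail.
  merge-Σ : ∀ {n} (e : Fin n → ℕ) → g (Σⁿ.sum e) +ʳ fromℕ n *ʳ g 0 ≤ʳ Σʳ.sum (g ∘ e) +ʳ g 0
  merge-Σ {zero}  e = ≐⇒≤ʳ {g 0 +ʳ 0ℝ *ʳ g 0} {0ℝ +ʳ g 0}
    λ n → solve 1 (λ o → o :+ con ℚ.0ℚ :* o := con ℚ.0ℚ :+ o) refl (seq (g 0) n)
  merge-Σ {suc m} e =
    ≤ʳ-by-≐ {g (e₀ + Σe) +ʳ g 0 +ʳ (g Σe +ʳ fromℕ m *ʳ g 0)} {g e₀ +ʳ g Σe +ʳ (Σge +ʳ g 0)}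
            {g (e₀ + Σe) +ʳ fromℕ (suc m) *ʳ g 0} {g e₀ +ʳ Σge +ʳ g 0}
      (+ʳ-mono-≤ʳ {g (e₀ + Σe) +ʳ g 0} {g e₀ +ʳ g Σe} {g Σe +ʳ fromℕ m *ʳ g 0} {Σge +ʳ g 0}
        (merge e₀ Σe) (merge-Σ (e ∘ suc)))
      λ n → trans
        (cong (λ N → (seq (g (e₀ + Σe)) n ℚ.+ N ℚ.* seq (g 0) n) ℚ.+ (seq (g e₀) n ℚ.+ seq (g Σe) n ℚ.+ (seq Σge n ℚ.+ seq (g 0) n)))
          (fromℕ-+ 1 m))
        (solve 6 (λ c a s S o M → (c :+ (con ℚ.1ℚ :+ M) :* o) :+ (a :+ s :+ (S :+ o)) := (c :+ o :+ (s :+ M :* o)) :+ (a :+ S :+ o)) refl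
          (seq (g (e₀ + Σe)) n) (seq (g e₀) n) (seq (g Σe) n) (seq Σge n) (seq (g 0) n) (ℤ.+ m ℚ./ 1))
    where
    e₀ = e zero
    Σe = Σⁿ.sum (e ∘ suc)
    Σge = Σʳ.sum (g ∘ e ∘ suc)

  module _ (m : ℕ) where
    private
      Δ = g (suc m) -ʳ g m

    -- Both sides carry a multiple of the slope Δ so that a ≥ m and a ≤ m read alike.
    tangentʳ : ∀ {a} → m ≤′ a → g a +ʳ fromℕ m *ʳ Δ ≤ʳ g m +ʳ fromℕ a *ʳ Δ
    tangentʳ ≤′-refl = ≤ʳ-refl {g m +ʳ fromℕ m *ʳ Δ}
    tangentʳ (≤′-step {a} m≤a) =
      ≤ʳ-by-≐ {g a +ʳ fromℕ m *ʳ Δ +ʳ (g m +ʳ g (suc a))} {g m +ʳ fromℕ a *ʳ Δ +ʳ (g (suc m) +ʳ g a)}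
              {g (suc a) +ʳ fromℕ m *ʳ Δ} {g m +ʳ fromℕ (suc a) *ʳ Δ}
        (+ʳ-mono-≤ʳ {g a +ʳ fromℕ m *ʳ Δ} {g m +ʳ fromℕ a *ʳ Δ} {g m +ʳ g (suc a)} {g (suc m) +ʳ g a}
          (tangentʳ m≤a) (slopes-decrease m≤a))
        λ n → trans
          (solve 6 (λ a a′ b b′ A B → (a′ :+ B :* (b′ :- b)) :+ (b :+ A :* (b′ :- b) :+ (b′ :+ a))
                    := (a :+ B :* (b′ :- b) :+ (b :+ a′)) :+ (b :+ (con ℚ.1ℚ :+ A) :* (b′ :- b))) refl
            (seq (g a) n) (seq (g (suc a)) n) (seq (g m) n) (seq (g (suc m)) n) (ℤ.+ a ℚ./ 1) (ℤ.+ m ℚ./ 1))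
          (cong (λ A → (seq (g a) n ℚ.+ (ℤ.+ m ℚ./ 1) ℚ.* seq Δ n ℚ.+ (seq (g m) n ℚ.+ seq (g (suc a)) n)) ℚ.+ (seq (g m) n ℚ.+ A ℚ.* seq Δ n))
            (sym (fromℕ-+ 1 a)))

    -- Below `m` every slope is at least `Δ`, so each step down lowers `g` by at least as much as
    -- the line. `_≤‴_` recurses on its lower end, which keeps `m` fixed.
    tangentˡ : ∀ {a} → a ≤‴ m → g a +ʳ fromℕ m *ʳ Δ ≤ʳ g m +ʳ fromℕ a *ʳ Δ
    tangentˡ ≤‴-refl = ≤ʳ-refl {g m +ʳ fromℕ m *ʳ Δ}
    tangentˡ {a} (≤‴-step a<m) =
      ≤ʳ-by-≐ {g (suc a) +ʳ fromℕ m *ʳ Δ +ʳ (g a +ʳ g (suc m))} {g m +ʳ fromℕ (suc a) *ʳ Δ +ʳ (g (suc a) +ʳ g m)}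
              {g a +ʳ fromℕ m *ʳ Δ} {g m +ʳ fromℕ a *ʳ Δ}
        (+ʳ-mono-≤ʳ {g (suc a) +ʳ fromℕ m *ʳ Δ} {g m +ʳ fromℕ (suc a) *ʳ Δ} {g a +ʳ g (suc m)} {g (suc a) +ʳ g m}
          (tangentˡ a<m) (slopes-decrease (≤⇒≤′ (<⇒≤ (≤‴⇒≤ a<m)))))
        λ n → trans
          (cong (λ A → (seq (g a) n ℚ.+ (ℤ.+ m ℚ./ 1) ℚ.* seq Δ n) ℚ.+ (seq (g m) n ℚ.+ A ℚ.* seq Δ n ℚ.+ (seq (g (suc a)) n ℚ.+ seq (g m) n)))
            (fromℕ-+ 1 a))
          (solve 6 (λ a a′ b b′ A B → (a :+ B :* (b′ :- b)) :+ (b :+ (con ℚ.1ℚ :+ A) :* (b′ :- b) :+ (a′ :+ b))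
                    := (a′ :+ B :* (b′ :- b) :+ (a :+ b′)) :+ (b :+ A :* (b′ :- b))) refl
            (seq (g a) n) (seq (g (suc a)) n) (seq (g m) n) (seq (g (suc m)) n) (ℤ.+ a ℚ./ 1) (ℤ.+ m ℚ./ 1))

    tangent : ∀ a → g a +ʳ fromℕ m *ʳ Δ ≤ʳ g m +ʳ fromℕ a *ʳ Δ
    tangent a with ≤-total a m
    ... | inj₁ a≤m = tangentˡ (≤⇒≤‴ a≤m)
    ... | inj₂ m≤a = tangentʳ (≤⇒≤′ m≤a)

private
  module ℝ⁺ = CommutativeMonoid ℝ-+-commutativeMonoid

isZero isSuc : ℕ → ℕ
isZero zero    = 1
isZero (suc _) = 0
isSuc zero    = 0
isSuc (suc _) = 1

-- Read x u as d_u - 1 and h i as f(i + 1), so that the p zeros of x are the pendant vertices.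
module Bounds (h : ℕ → ℝ) (concave : Concave (h ∘ suc))
  {k p} (x : Fin (k + p) → ℕ) (Σx≡k+p : Σⁿ.sum x ≡ k + p) (zeros : Σⁿ.sum (isZero ∘ x) ≡ p)
  where
  open ConcaveSequence {h ∘ suc} concave
  open +-*-Solver

  private
    g = h ∘ suc
    H = Σʳ.sum (h ∘ x)

  sucs : Σⁿ.sum (isSuc ∘ x) ≡ k
  sucs = +-cancelʳ-≡ p _ _ (begin
    Σⁿ.sum (isSuc ∘ x) + p                        ≡⟨ cong (λ c → Σⁿ.sum (isSuc ∘ x) + c) zeros ⟨
    Σⁿ.sum (isSuc ∘ x) + Σⁿ.sum (isZero ∘ x)      ≡⟨ Σⁿ.∑-distrib-+ (isSuc ∘ x) (isZero ∘ x) ⟨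
    Σⁿ.sum (λ u → isSuc (x u) + isZero (x u))     ≡⟨ Σⁿ.sum-cong-≗ (λ u → split (x u)) ⟩
    Σⁿ.sum {k + p} (λ _ → 1)                      ≡⟨ Σ-const-1 (k + p) ⟩
    k + p                                         ∎)
    where
    open ≡-Reasoning
    split : ∀ y → isSuc y + isZero y ≡ 1
    split zero    = refl
    split (suc _) = refl

  -- Truncation in `pred` gives pendant vertices excess 0 instead of -1, so only the k other
  -- vertices lose a unit from the total k + p.
  Σpred≡p : Σⁿ.sum (pred ∘ x) ≡ p
  Σpred≡p = +-cancelʳ-≡ k _ _ (begin
    Σⁿ.sum (pred ∘ x) + k                       ≡⟨ cong (λ c → Σⁿ.sum (pred ∘ x) + c) sucs ⟨
    Σⁿ.sum (pred ∘ x) + Σⁿ.sum (isSuc ∘ x)      ≡⟨ Σⁿ.∑-distrib-+ (pred ∘ x) (isSuc ∘ x) ⟨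
    Σⁿ.sum (λ u → pred (x u) + isSuc (x u))     ≡⟨ Σⁿ.sum-cong-≗ (λ u → split (x u)) ⟩
    Σⁿ.sum x                                    ≡⟨ Σx≡k+p ⟩
    k + p                                       ≡⟨ +-comm k p ⟩
    p + k                                       ∎)
    where
    open ≡-Reasoning
    split : ∀ y → pred y + isSuc y ≡ y
    split zero    = refl
    split (suc y) = +-comm y 1

  private
    -- Treats each pendant vertex as if it had degree 2, at the price of exchanging `h 0` for `g 0`.
    -- All remaining values then lie where concavity is known.
    zeros-as-ones : H +ʳ fromℕ p *ʳ g 0 ≐ fromℕ p *ʳ h 0 +ʳ Σʳ.sum (g ∘ pred ∘ x)
    zeros-as-ones = begin
      H +ʳ fromℕ p *ʳ g 0
        ≈⟨ (λ n → cong (seq H n ℚ.+_) (scale (g 0) n)) ⟩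
      H +ʳ Σʳ.sum (λ u → fromℕ (isZero (x u)) *ʳ g 0)
        ≈⟨ Σʳ.∑-distrib-+ (h ∘ x) (λ u → fromℕ (isZero (x u)) *ʳ g 0) ⟨
      Σʳ.sum (λ u → h (x u) +ʳ fromℕ (isZero (x u)) *ʳ g 0)
        ≈⟨ Σʳ.sum-cong-≋ {k + p} {λ u → h (x u) +ʳ fromℕ (isZero (x u)) *ʳ g 0}
             {λ u → fromℕ (isZero (x u)) *ʳ h 0 +ʳ g (pred (x u))} (λ u → shift (x u)) ⟩
      Σʳ.sum (λ u → fromℕ (isZero (x u)) *ʳ h 0 +ʳ g (pred (x u)))
        ≈⟨ Σʳ.∑-distrib-+ (λ u → fromℕ (isZero (x u)) *ʳ h 0) (g ∘ pred ∘ x) ⟩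
      Σʳ.sum (λ u → fromℕ (isZero (x u)) *ʳ h 0) +ʳ Σʳ.sum (g ∘ pred ∘ x)
        ≈⟨ (λ n → cong (ℚ._+ seq (Σʳ.sum (g ∘ pred ∘ x)) n) (scale (h 0) n)) ⟨
      fromℕ p *ʳ h 0 +ʳ Σʳ.sum (g ∘ pred ∘ x)
        ∎
      where
      open import Relation.Binary.Reasoning.Setoid ℝ⁺.setoid
      scale : ∀ y → fromℕ p *ʳ y ≐ Σʳ.sum (λ u → fromℕ (isZero (x u)) *ʳ y)
      scale y n = sym (trans (Σ-fromℕ-* (isZero ∘ x) y n) (cong (λ c → (ℤ.+ c ℚ./ 1) ℚ.* seq y n) zeros))
      shift : ∀ y → h y +ʳ fromℕ (isZero y) *ʳ g 0 ≐ fromℕ (isZero y) *ʳ h 0 +ʳ g (pred y)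
      shift zero n = solve 2 (λ a b → a :+ con ℚ.1ℚ :* b := con ℚ.1ℚ :* a :+ b) refl
        (seq (h 0) n) (seq (g 0) n)
      shift (suc y) n = solve 3 (λ a b c → c :+ con ℚ.0ℚ :* b := con ℚ.0ℚ :* a :+ c) refl
        (seq (h 0) n) (seq (g 0) n) (seq (g y) n)

  -- `merge-Σ` runs over all k + p vertices, the pendant ones having excess 0. Their p surplus
  -- copies of `g 0` cancel against those in `zeros-as-ones`, which leaves k - 1.
  lower-bound : 1 ≤ k → g p +ʳ fromℕ (k ∸ 1) *ʳ g 0 +ʳ fromℕ p *ʳ h 0 ≤ʳ H
  lower-bound 1≤k = ≤ʳ-by-≐ {g (Σⁿ.sum (pred ∘ x)) +ʳ fromℕ (k + p) *ʳ g 0} {G +ʳ g 0}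
    {g p +ʳ fromℕ (k ∸ 1) *ʳ g 0 +ʳ fromℕ p *ʳ h 0} {H}
    (merge-Σ (pred ∘ x)) λ n →
    let gp = seq (g p) n; g0 = seq (g 0) n; h0 = seq (h 0) n; P = ℤ.+ p ℚ./ 1; K = ℤ.+ (k ∸ 1) ℚ./ 1
        open ≡-Reasoning
    in begin
    (gp ℚ.+ K ℚ.* g0 ℚ.+ P ℚ.* h0) ℚ.+ (seq G n ℚ.+ g0)
      ≡⟨ solve 6 (λ gp g0 h0 P K G → (gp :+ K :* g0 :+ P :* h0) :+ (G :+ g0) := (gp :+ (K :+ con ℚ.1ℚ) :* g0) :+ (P :* h0 :+ G)) refl gp g0 h0 P K (seq G n) ⟩
    (gp ℚ.+ (K ℚ.+ ℚ.1ℚ) ℚ.* g0) ℚ.+ (P ℚ.* h0 ℚ.+ seq G n)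
      ≡⟨ cong ((gp ℚ.+ (K ℚ.+ ℚ.1ℚ) ℚ.* g0) ℚ.+_) (zeros-as-ones n) ⟨
    (gp ℚ.+ (K ℚ.+ ℚ.1ℚ) ℚ.* g0) ℚ.+ (seq H n ℚ.+ P ℚ.* g0)
      ≡⟨ solve 5 (λ gp g0 P K H → (gp :+ K :* g0) :+ (H :+ P :* g0) := (gp :+ (K :+ P) :* g0) :+ H) refl gp g0 P (K ℚ.+ ℚ.1ℚ) (seq H n) ⟩
    (gp ℚ.+ (K ℚ.+ ℚ.1ℚ ℚ.+ P) ℚ.* g0) ℚ.+ seq H n
      ≡⟨ cong₂ (λ q N → (seq (g q) n ℚ.+ N ℚ.* g0) ℚ.+ seq H n) (sym Σpred≡p) casts ⟩
    (seq (g (Σⁿ.sum (pred ∘ x))) n ℚ.+ (ℤ.+ (k + p) ℚ./ 1) ℚ.* g0) ℚ.+ seq H n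
      ∎
    where
    G = Σʳ.sum (g ∘ pred ∘ x)
    casts : (ℤ.+ (k ∸ 1) ℚ./ 1) ℚ.+ ℚ.1ℚ ℚ.+ (ℤ.+ p ℚ./ 1) ≡ ℤ.+ (k + p) ℚ./ 1
    casts = trans (cong (ℚ._+ (ℤ.+ p ℚ./ 1)) (trans (sym (fromℕ-+ (k ∸ 1) 1)) (cong (λ c → ℤ.+ c ℚ./ 1) (m∸n+n≡m 1≤k))))
      (sym (fromℕ-+ k p))

  -- Since `g m` is f(m + 2), this `m` is that of the theorem minus two. Summing `tangent` over the
  -- k non-pendant vertices gives k copies of `g m` and p - mk = t copies of the slope, each of
  -- which turns one `g m` into `g (suc m)`.
  upper-bound : ∀ m t → t ≤ k → p ≡ t + m * k →
    H ≤ʳ fromℕ t *ʳ g (suc m) +ʳ fromℕ (k ∸ t) *ʳ g m +ʳ fromℕ p *ʳ h 0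
  upper-bound m t t≤k p≡t+mk = ≤ʳ-by-≐ {Σʳ.sum L} {Σʳ.sum R} {H}
    {fromℕ t *ʳ g (suc m) +ʳ fromℕ (k ∸ t) *ʳ g m +ʳ fromℕ p *ʳ h 0}
    (Σ-mono-≤ʳ L R (λ u → pointwise (x u))) λ n →
    let gm = seq (g m) n; gm′ = seq (g (suc m)) n; h0 = seq (h 0) n
        P = ℤ.+ p ℚ./ 1; T = ℤ.+ t ℚ./ 1; D = ℤ.+ (k ∸ t) ℚ./ 1; KM = ℤ.+ (m * k) ℚ./ 1
        open ≡-Reasoning
    in begin
    seq H n ℚ.+ seq (Σʳ.sum R) n
      ≡⟨ cong (seq H n ℚ.+_) (ΣR n) ⟩
    seq H n ℚ.+ (P ℚ.* h0 ℚ.+ (ℤ.+ k ℚ./ 1) ℚ.* gm ℚ.+ P ℚ.* (gm′ ℚ.- gm))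
      ≡⟨ cong₂ (λ K Q → seq H n ℚ.+ (P ℚ.* h0 ℚ.+ K ℚ.* gm ℚ.+ Q ℚ.* (gm′ ℚ.- gm))) k-cast p-cast ⟩
    seq H n ℚ.+ (P ℚ.* h0 ℚ.+ (T ℚ.+ D) ℚ.* gm ℚ.+ (T ℚ.+ KM) ℚ.* (gm′ ℚ.- gm))
      ≡⟨ solve 8 (λ H P h0 T D gm KM gm′ → H :+ (P :* h0 :+ (T :+ D) :* gm :+ (T :+ KM) :* (gm′ :- gm))
            := (H :+ KM :* (gm′ :- gm)) :+ (T :* gm′ :+ D :* gm :+ P :* h0)) refl (seq H n) P h0 T D gm KM gm′ ⟩
    (seq H n ℚ.+ KM ℚ.* (gm′ ℚ.- gm)) ℚ.+ (T ℚ.* gm′ ℚ.+ D ℚ.* gm ℚ.+ P ℚ.* h0)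
      ≡⟨ cong (ℚ._+ (T ℚ.* gm′ ℚ.+ D ℚ.* gm ℚ.+ P ℚ.* h0)) (ΣL n) ⟨
    seq (Σʳ.sum L) n ℚ.+ (T ℚ.* gm′ ℚ.+ D ℚ.* gm ℚ.+ P ℚ.* h0)
      ∎
    where
    Δ = g (suc m) -ʳ g m
    L R : Fin (k + p) → ℝ
    -- The two sides of `tangent` at the excess of `u`; the indicators switch it off at pendant
    -- vertices, where `h 0` is only compared with itself.
    L u = h (x u) +ʳ fromℕ (isSuc (x u) * m) *ʳ Δ
    R u = fromℕ (isZero (x u)) *ʳ h 0 +ʳ fromℕ (isSuc (x u)) *ʳ g m +ʳ fromℕ (pred (x u)) *ʳ Δ

    pointwise : ∀ y → h y +ʳ fromℕ (isSuc y * m) *ʳ Δ ≤ʳ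
      fromℕ (isZero y) *ʳ h 0 +ʳ fromℕ (isSuc y) *ʳ g m +ʳ fromℕ (pred y) *ʳ Δ
    pointwise zero = ≐⇒≤ʳ {h 0 +ʳ 0ℝ *ʳ Δ} {1ℝ *ʳ h 0 +ʳ 0ℝ *ʳ g m +ʳ 0ℝ *ʳ Δ} λ n →
      solve 3 (λ a b c → a :+ con ℚ.0ℚ :* c := con ℚ.1ℚ :* a :+ con ℚ.0ℚ :* b :+ con ℚ.0ℚ :* c) refl
        (seq (h 0) n) (seq (g m) n) (seq Δ n)
    pointwise (suc y) rewrite +-identityʳ m =
      ≤ʳ-by-≐ {g y +ʳ fromℕ m *ʳ Δ} {g m +ʳ fromℕ y *ʳ Δ}
        {g y +ʳ fromℕ m *ʳ Δ} {0ℝ *ʳ h 0 +ʳ 1ℝ *ʳ g m +ʳ fromℕ y *ʳ Δ} (tangent m y) λ n →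
      solve 6 (λ a b c d e h → (a :+ e :* d) :+ (b :+ c :* d) := (a :+ e :* d) :+ (con ℚ.0ℚ :* h :+ con ℚ.1ℚ :* b :+ c :* d)) refl
        (seq (g y) n) (seq (g m) n) (ℤ.+ y ℚ./ 1) (seq Δ n) (ℤ.+ m ℚ./ 1) (seq (h 0) n)

    cast : ∀ {a b} y n → a ≡ b → (ℤ.+ a ℚ./ 1) ℚ.* seq y n ≡ (ℤ.+ b ℚ./ 1) ℚ.* seq y n
    cast y n = cong λ c → (ℤ.+ c ℚ./ 1) ℚ.* seq y n

    ΣL : Σʳ.sum L ≐ H +ʳ fromℕ (m * k) *ʳ Δ
    ΣL n = trans (Σʳ.∑-distrib-+ (h ∘ x) (λ u → fromℕ (isSuc (x u) * m) *ʳ Δ) n)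
      (cong (seq H n ℚ.+_) (trans (Σ-fromℕ-* (λ u → isSuc (x u) * m) Δ n) (cast Δ n
        (trans (sym (Σⁿ.*-distribʳ-sum m (isSuc ∘ x))) (trans (cong (_* m) sucs) (*-comm k m))))))

    ΣR : Σʳ.sum R ≐ fromℕ p *ʳ h 0 +ʳ fromℕ k *ʳ g m +ʳ fromℕ p *ʳ Δ
    ΣR n = trans (Σʳ.∑-distrib-+ (λ u → fromℕ (isZero (x u)) *ʳ h 0 +ʳ fromℕ (isSuc (x u)) *ʳ g m) (λ u → fromℕ (pred (x u)) *ʳ Δ) n)
      (cong₂ ℚ._+_
        (trans (Σʳ.∑-distrib-+ (λ u → fromℕ (isZero (x u)) *ʳ h 0) (λ u → fromℕ (isSuc (x u)) *ʳ g m) n)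
          (cong₂ ℚ._+_
            (trans (Σ-fromℕ-* (isZero ∘ x) (h 0) n) (cast (h 0) n zeros))
            (trans (Σ-fromℕ-* (isSuc ∘ x) (g m) n) (cast (g m) n sucs))))
        (trans (Σ-fromℕ-* (pred ∘ x) Δ n) (cast Δ n Σpred≡p)))

    k-cast : ℤ.+ k ℚ./ 1 ≡ (ℤ.+ t ℚ./ 1) ℚ.+ (ℤ.+ (k ∸ t) ℚ./ 1)
    k-cast = trans (cong (λ c → ℤ.+ c ℚ./ 1) (sym (m+[n∸m]≡n t≤k))) (fromℕ-+ t (k ∸ t))

    p-cast : ℤ.+ p ℚ./ 1 ≡ (ℤ.+ t ℚ./ 1) ℚ.+ (ℤ.+ (m * k) ℚ./ 1)
    p-cast = trans (cong (λ c → ℤ.+ c ℚ./ 1) p≡t+mk) (fromℕ-+ t (m * k))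

-- Counting

-- Only `does` is inspected, and for `Fin.≟` it reduces on constructors; hence the `suc` case of
-- `Σ-⟦≟⟧` is its induction hypothesis on the nose.
⟦_⟧ : ∀ {P : Set} → Dec P → ℕ
⟦ P? ⟧ = if does P? then 1 else 0

length-filter-tabulate : ∀ {A : Set} {P : A → Set} (P? : Unary.Decidable P) {n} (f : Fin n → A) →
  length (filter P? (tabulate f)) ≡ Σⁿ.sum (λ i → ⟦ P? (f i) ⟧)
length-filter-tabulate P? {zero}  f = refl
length-filter-tabulate P? {suc n} f with does (P? (f zero))
... | true  = cong suc (length-filter-tabulate P? (f ∘ suc))
... | false = length-filter-tabulate P? (f ∘ suc)

⟦⟧-cong : ∀ {P Q : Set} (P? : Dec P) (Q? : Dec Q) → (P → Q) → (Q → P) → ⟦ P? ⟧ ≡ ⟦ Q? ⟧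
⟦⟧-cong (yes p) (yes q) _   _   = refl
⟦⟧-cong (yes p) (no ¬q) P⇒Q _   = contradiction (P⇒Q p) ¬q
⟦⟧-cong (no ¬p) (yes q) _   Q⇒P = contradiction (Q⇒P q) ¬p
⟦⟧-cong (no ¬p) (no ¬q) _   _   = refl

⟦⟧-no : ∀ {P : Set} (P? : Dec P) → ¬ P → ⟦ P? ⟧ ≡ 0
⟦⟧-no (yes p) ¬p = contradiction p ¬p
⟦⟧-no (no _)  _  = refl

⟦⟧-⊎ : ∀ {P Q R : Set} (P? : Dec P) (Q? : Dec Q) (R? : Dec R) →
  (R → P ⊎ Q) → (P → R) → (Q → R) → (P → ¬ Q) → ⟦ R? ⟧ ≡ ⟦ P? ⟧ + ⟦ Q? ⟧
⟦⟧-⊎ (yes p) (yes q) _       _   _   _   ¬PQ = contradiction q (¬PQ p)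
⟦⟧-⊎ (yes p) (no ¬q) (yes r) _   _   _   _   = refl
⟦⟧-⊎ (yes p) (no ¬q) (no ¬r) _   P⇒R _   _   = contradiction (P⇒R p) ¬r
⟦⟧-⊎ (no ¬p) (yes q) (yes r) _   _   _   _   = refl
⟦⟧-⊎ (no ¬p) (yes q) (no ¬r) _   _   Q⇒R _   = contradiction (Q⇒R q) ¬r
⟦⟧-⊎ (no ¬p) (no ¬q) (yes r) R⇒  _   _   _   = contradiction (R⇒ r) [ ¬p , ¬q ]′
⟦⟧-⊎ (no ¬p) (no ¬q) (no ¬r) _   _   _   _   = refl

Σ-⟦≟⟧ : ∀ {n} (i : Fin n) → Σⁿ.sum (λ j → ⟦ i Fin.≟ j ⟧) ≡ 1
Σ-⟦≟⟧ {suc n} zero    = cong suc (Σⁿ.sum-replicate-zero n)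
Σ-⟦≟⟧         (suc i) = Σ-⟦≟⟧ i

least : ∀ {P : ℕ → Set} → Unary.Decidable P → ∀ {k} → P k → ∃[ j ] P j × (∀ {i} → P i → j ≤ i)
least P? {k} Pk with P? 0
least P? {k}     Pk | yes P0 = 0 , P0 , λ _ → z≤n
least P? {zero}  Pk | no ¬P0 = contradiction Pk ¬P0
least P? {suc k} Pk | no ¬P0 with least (P? ∘ suc) Pk
... | j , Pj , min = suc j , Pj , λ { {zero} P0 → contradiction P0 ¬P0 ; {suc i} Pi → s≤s (min Pi) }

-- Cyclic lists and simple paths

module _ {A : Set} where

  -- pairs v vs v is definitionally cyclicPairs (v ∷ vs).
  pairs : A → List A → A → List (A × A)
  pairs v vs w = zip (v ∷ vs) (vs ∷ʳ w)

  ∈-pairs-next : ∀ {v vs w x} → x ∈ v ∷ vs → ∃[ y ] (x , y) ∈ pairs v vs w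
  ∈-pairs-next {vs = []}    (here refl) = _ , here refl
  ∈-pairs-next {vs = _ ∷ _} (here refl) = _ , here refl
  ∈-pairs-next {vs = _ ∷ _} (there x∈)  = map₂ there (∈-pairs-next x∈)

  ∈-pairs-previous : ∀ {v vs w y} → y ∈ vs ∷ʳ w → ∃[ x ] (x , y) ∈ pairs v vs w
  ∈-pairs-previous {vs = []}    (here refl) = _ , here refl
  ∈-pairs-previous {vs = _ ∷ _} (here refl) = _ , here refl
  ∈-pairs-previous {vs = _ ∷ _} (there y∈)  = map₂ there (∈-pairs-previous y∈)

  ∈-pairs⇒∈ˡ : ∀ {v vs w x y} → (x , y) ∈ pairs v vs w → x ∈ v ∷ vs
  ∈-pairs⇒∈ˡ {vs = []}    (here refl) = here refl
  ∈-pairs⇒∈ˡ {vs = _ ∷ _} (here refl) = here refl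
  ∈-pairs⇒∈ˡ {vs = _ ∷ _} (there xy∈) = there (∈-pairs⇒∈ˡ xy∈)

  ∈-pairs⇒∈ʳ : ∀ {v vs w x y} → (x , y) ∈ pairs v vs w → y ∈ vs ⊎ y ≡ w
  ∈-pairs⇒∈ʳ {vs = []}    (here refl) = inj₂ refl
  ∈-pairs⇒∈ʳ {vs = _ ∷ _} (here refl) = inj₁ (here refl)
  ∈-pairs⇒∈ʳ {vs = _ ∷ _} (there xy∈) = Sum.map₁ there (∈-pairs⇒∈ʳ xy∈)

  pairs-functional : ∀ {v vs w x y z} → Unique (v ∷ vs) →
    (x , y) ∈ pairs v vs w → (x , z) ∈ pairs v vs w → y ≡ z
  pairs-functional {vs = []}    _ (here refl) (here refl) = refl
  pairs-functional {vs = _ ∷ _} _ (here refl) (here refl) = refl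
  pairs-functional {vs = _ ∷ _} (v∉ ∷ _) (here refl) (there xz∈) = contradiction (∈-pairs⇒∈ˡ xz∈) (All¬⇒¬Any v∉)
  pairs-functional {vs = _ ∷ _} (v∉ ∷ _) (there xy∈) (here refl) = contradiction (∈-pairs⇒∈ˡ xy∈) (All¬⇒¬Any v∉)
  pairs-functional {vs = _ ∷ _} (_ ∷ unique) (there xy∈) (there xz∈) = pairs-functional unique xy∈ xz∈

  private
    first-pair : ∀ {v vs w} → Unique (v ∷ vs) → w ∉ vs → (v , w) ∈ pairs v vs w → length vs ≡ 0
    first-pair {vs = []} _ _ _ = refl
    first-pair {vs = _ ∷ _} unique w∉ vw∈ = contradiction (here (pairs-functional unique vw∈ (here refl))) w∉

  -- If the first pair is one of the two, the other leads back to `v`; as `v` does not recur in the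
  -- list, it must be the end `w`, reached right after the second vertex. Keeping `w` independent of
  -- `v` is what lets the induction pass to the tail.
  pairs-symmetric⇒short : ∀ {v vs w x y} → Unique (v ∷ vs) → w ∉ vs →
    (x , y) ∈ pairs v vs w → (y , x) ∈ pairs v vs w → v ≡ w × length vs ≤ 1
  pairs-symmetric⇒short {vs = []} _ _ (here refl) (here refl) = refl , z≤n
  pairs-symmetric⇒short {vs = _ ∷ _} (v∉ ∷ _) _ (here refl) (here refl) = contradiction (here refl) (All¬⇒¬Any v∉)
  pairs-symmetric⇒short {vs = _ ∷ _} (v∉ ∷ unique) w∉ (here refl) (there yx∈) = closing v∉ unique w∉ yx∈
    where
    closing : ∀ {v u us w} → All (v ≢_) (u ∷ us) → Unique (u ∷ us) → w ∉ u ∷ us → (u , v) ∈ pairs u us w → v ≡ w × length (u ∷ us) ≤ 1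
    closing v∉ unique w∉ uv∈ with ∈-pairs⇒∈ʳ uv∈
    ... | inj₁ v∈us = contradiction (there v∈us) (All¬⇒¬Any v∉)
    ... | inj₂ refl = refl , s≤s (≤-reflexive (first-pair unique (w∉ ∘ there) uv∈))
  pairs-symmetric⇒short {vs = _ ∷ _} (v∉ ∷ unique) w∉ (there xy∈) (here refl) = 
    pairs-symmetric⇒short (v∉ ∷ unique) w∉ (here refl) (there xy∈)
  -- The induction hypothesis would make the head of the tail equal to `w`, which `w∉` forbids.
  pairs-symmetric⇒short {vs = _ ∷ _} (v∉ ∷ unique) w∉ (there xy∈) (there yx∈) =
    contradiction (here (sym (proj₁ (pairs-symmetric⇒short unique (w∉ ∘ there) xy∈ yx∈)))) w∉

  walk-along-pairs : ∀ {R : Rel A 0ℓ} {v vs w x} → (∀ {a b} → (a , b) ∈ pairs v vs w → R a b) →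
    x ∈ v ∷ vs → Star R v x
  walk-along-pairs              R⊇ (here refl) = ε
  walk-along-pairs {vs = _ ∷ _} R⊇ (there x∈)  = R⊇ (here refl) ◅ walk-along-pairs (R⊇ ∘ there) x∈

module _ {A : Set} where

  ∈-next : ∀ {x} {xs : List A} → x ∈ xs → ∃[ y ] (x , y) ∈ cyclicPairs xs
  ∈-next {xs = _ ∷ _} = ∈-pairs-next

  ∈-previous : ∀ {y} {xs : List A} → y ∈ xs → ∃[ x ] (x , y) ∈ cyclicPairs xs
  ∈-previous {xs = _ ∷ vs} (here refl) = ∈-pairs-previous (∈-++⁺ʳ vs (here refl))
  ∈-previous {xs = _ ∷ _}  (there y∈)  = ∈-pairs-previous (∈-++⁺ˡ y∈)

  ∈-cyclicPairs⇒∈ˡ : ∀ {x y} {xs : List A} → (x , y) ∈ cyclicPairs xs → x ∈ xs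
  ∈-cyclicPairs⇒∈ˡ {xs = _ ∷ _} = ∈-pairs⇒∈ˡ

  ∈-cyclicPairs⇒∈ʳ : ∀ {x y} {xs : List A} → (x , y) ∈ cyclicPairs xs → y ∈ xs
  ∈-cyclicPairs⇒∈ʳ {xs = _ ∷ _} xy∈ = [ there , here ]′ (∈-pairs⇒∈ʳ xy∈)

  cyclicPairs-functional : ∀ {x y z} {xs : List A} → Unique xs →
    (x , y) ∈ cyclicPairs xs → (x , z) ∈ cyclicPairs xs → y ≡ z
  cyclicPairs-functional {xs = _ ∷ _} = pairs-functional

  cyclicPairs-asymmetric : ∀ {x y} {xs : List A} → Unique xs → 3 ≤ length xs →
    (x , y) ∈ cyclicPairs xs → ¬ (y , x) ∈ cyclicPairs xs
  cyclicPairs-asymmetric {xs = _ ∷ _} unique@(v∉ ∷ _) (s≤s 2≤) xy∈ yx∈ =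
    <⇒≱ 2≤ (proj₂ (pairs-symmetric⇒short unique (All¬⇒¬Any v∉) xy∈ yx∈))

  cyclicPairs-connected : ∀ {R : Rel A 0ℓ} {x y} {xs : List A} → Symmetric R →
    (∀ {a b} → (a , b) ∈ cyclicPairs xs → R a b) → x ∈ xs → y ∈ xs → Star R x y
  cyclicPairs-connected {xs = _ ∷ _} R-sym R⊇ x∈ y∈ =
    Star.reverse R-sym (walk-along-pairs R⊇ x∈) ◅◅ walk-along-pairs R⊇ y∈

  nonempty : ∀ {k} {xs : List A} → suc k ≤ length xs → ∃ (_∈ xs)
  nonempty {xs = x ∷ _} _ = x , here refl

data Path {A : Set} (R : Rel A 0ℓ) : A → List A → A → Set where
  []  : ∀ {u} → Path R u [] u
  _∷_ : ∀ {u v vs w} → R u v → Path R v vs w → Path R u (v ∷ vs) w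

module _ {A : Set} {R : Rel A 0ℓ} where

  suffix-from : ∀ {u vs w y} → y ∈ u ∷ vs → Path R u vs w → Unique (u ∷ vs) →
    ∃[ ys ] Path R y ys w × Unique (y ∷ ys)
  suffix-from (here refl) path       unique       = _ , path , unique
  suffix-from (there y∈)  (_ ∷ path) (_ ∷ unique) = suffix-from y∈ path unique

  -- Loop erasure: if the start recurs on the simplified rest, everything before that recurrence is
  -- dropped.
  simplePath : DecidableEquality A → ∀ {u w} → Star R u w → ∃[ vs ] Path R u vs w × Unique (u ∷ vs)
  simplePath _≟_ ε = [] , [] , [] ∷ []
  simplePath _≟_ (_◅_ {u} {v} Ruv walk) with simplePath _≟_ walk
  ... | vs , path , unique with member? _≟_ u (v ∷ vs)
  ...   | yes u∈ = suffix-from u∈ path unique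
  ...   | no  u∉ = v ∷ vs , Ruv ∷ path , ¬Any⇒All¬ _ u∉ ∷ unique

  pairs-last : ∀ {u vs w z} → Path R u vs w → (w , z) ∈ pairs u vs z
  pairs-last []         = here refl
  pairs-last (_ ∷ path) = there (pairs-last path)

  All-pairs : ∀ {Q : Rel A 0ℓ} {u vs w z} → (∀ {a b} → R a b → Q a b) → Path R u vs w → Q w z →
    All (uncurry Q) (pairs u vs z)
  All-pairs R⇒Q []           Qwz = Qwz ∷ []
  All-pairs R⇒Q (Rab ∷ path) Qwz = R⇒Q Rab ∷ All-pairs R⇒Q path Qwz

-- Oriented graphs

record Orientation {n} (G : Graph n) (s : Fin n → Fin n) : Set where
  open Graph G
  field
    successor-adjacent : ∀ u → u ~ s u
    adjacent-oriented  : ∀ {u v} → u ~ v → s u ≡ v ⊎ s v ≡ u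
    antisymmetric      : ∀ u → s (s u) ≢ u

  fibre : Fin n → ℕ
  fibre u = Σⁿ.sum (λ v → ⟦ s v Fin.≟ u ⟧)

  -- The neighbours of `u` are its successor and its preimages under `s`; `antisymmetric` keeps the
  -- two kinds disjoint.
  degree≡1+fibre : ∀ u → degree u ≡ suc (fibre u)
  degree≡1+fibre u = begin
    degree u                                                             ≡⟨ length-filter-tabulate (u ~?_) (λ v → v) ⟩
    Σⁿ.sum (λ v → ⟦ u ~? v ⟧)                                            ≡⟨ Σⁿ.sum-cong-≗ (λ v → ⟦⟧-⊎ (s u Fin.≟ v) (s v Fin.≟ u) (u ~? v)
                                                                              adjacent-oriented
                                                                              (λ { refl → successor-adjacent u })
                                                                              (λ { refl → symmetric (successor-adjacent v) })
                                                                              (λ { refl → antisymmetric u })) ⟩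
    Σⁿ.sum (λ v → ⟦ s u Fin.≟ v ⟧ + ⟦ s v Fin.≟ u ⟧)                     ≡⟨ Σⁿ.∑-distrib-+ (λ v → ⟦ s u Fin.≟ v ⟧) (λ v → ⟦ s v Fin.≟ u ⟧) ⟩
    Σⁿ.sum (λ v → ⟦ s u Fin.≟ v ⟧) + fibre u                             ≡⟨ cong (_+ fibre u) (Σ-⟦≟⟧ (s u)) ⟩
    suc (fibre u)                                                        ∎
    where open ≡-Reasoning

  pendantCount≡ : pendantCount ≡ Σⁿ.sum (isZero ∘ fibre)
  pendantCount≡ = trans (length-filter-tabulate (λ u → degree u ≟ 1) (λ u → u))
    (Σⁿ.sum-cong-≗ (λ u → trans (cong (λ d → ⟦ d ≟ 1 ⟧) (degree≡1+fibre u)) (pendant (fibre u))))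
    where
    pendant : ∀ x → ⟦ suc x ≟ 1 ⟧ ≡ isZero x
    pendant zero    = refl
    pendant (suc x) = refl

  Σ-fibre : Σⁿ.sum fibre ≡ n
  Σ-fibre = begin
    Σⁿ.sum (λ u → Σⁿ.sum (λ v → ⟦ s v Fin.≟ u ⟧))  ≡⟨ Σⁿ.∑-comm (λ u v → ⟦ s v Fin.≟ u ⟧) ⟩
    Σⁿ.sum (λ v → Σⁿ.sum (λ u → ⟦ s v Fin.≟ u ⟧))  ≡⟨ Σⁿ.sum-cong-≗ (λ v → Σ-⟦≟⟧ (s v)) ⟩
    Σⁿ.sum {n} (λ _ → 1)                           ≡⟨ Σ-const-1 n ⟩
    n                                              ∎
    where open ≡-Reasoning

-- The witness ρ is the graph distance to T.
descent-to : ∀ {n} (G : Graph n) {T : Fin n → Set} → Unary.Decidable T → ∃ T →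
  let open Graph G in ∃[ ρ ] ∀ u → ¬ T u → ∃[ v ] u ~ v × ρ v < ρ u
descent-to {n} G {T} T? (t , Tt) = (λ u → proj₁ (shortest u)) , λ u ¬Tu → closer ¬Tu (shortest u)
  where
  open Graph G

  -- Fixing the exact length makes the predicate decidable by recursion on it, as `least` requires.
  WalkToT : Fin n → ℕ → Set
  WalkToT u zero    = T u
  WalkToT u (suc k) = ∃[ v ] u ~ v × WalkToT v k

  walkToT? : ∀ u → Unary.Decidable (WalkToT u)
  walkToT? u zero    = T? u
  walkToT? u (suc k) = Fin.any? λ v → (u ~? v) ×-dec walkToT? v k

  walkToT : ∀ {u} → Star _~_ u t → ∃ (WalkToT u)
  walkToT ε            = 0 , Tt
  walkToT (u~v ◅ walk) = map suc (λ w → _ , u~v , w) (walkToT walk)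

  shortest : ∀ u → ∃[ k ] WalkToT u k × (∀ {i} → WalkToT u i → k ≤ i)
  shortest u = let k , walk = walkToT (connected u t) in least (walkToT? u) {k} walk

  closer : ∀ {u} → ¬ T u → ((k , _) : ∃[ k ] WalkToT u k × (∀ {i} → WalkToT u i → k ≤ i)) →
    ∃[ v ] u ~ v × proj₁ (shortest v) < k
  closer ¬Tu (zero  , Tu , _)               = contradiction Tu ¬Tu
  closer ¬Tu (suc k , (v , u~v , walk) , _) = v , u~v , s≤s (proj₂ (proj₂ (shortest v)) walk)

-- The orientation of a unicyclic graph

module _ {n} {G : Graph n} (C : Cycle G) (unique : ∀ D → SameCycle G C D) where
  open Graph G
  open Cycle C

  module TowardsCycle (s : Fin n → Fin n) (ρ : Fin n → ℕ) (adjacent : ∀ u → u ~ s u)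
    (step : ∀ u → (u , s u) ∈ cyclicPairs vertices ⊎ (u ∉ vertices × ρ (s u) < ρ u)) where

    Oriented : Rel (Fin n) 0ℓ
    Oriented u v = s u ≡ v ⊎ s v ≡ u

    oriented? : Decidable Oriented
    oriented? u v = (s u Fin.≟ v) ⊎-dec (s v Fin.≟ u)

    successor-on-cycle : ∀ {u v} → (u , v) ∈ cyclicPairs vertices → s u ≡ v
    successor-on-cycle {u} uv∈ with step u
    ... | inj₁ usu∈     = cyclicPairs-functional distinct usu∈ uv∈
    ... | inj₂ (u∉ , _) = contradiction (∈-cyclicPairs⇒∈ˡ uv∈) u∉

    oriented⇒adjacent : ∀ {u v} → Oriented u v → u ~ v
    oriented⇒adjacent (inj₁ refl) = adjacent _
    oriented⇒adjacent (inj₂ refl) = symmetric (adjacent _)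

    module _ {c} (c∈ : c ∈ vertices) where

      -- Off the cycle `s` strictly lowers `ρ`, so following it ends on the cycle, all of whose
      -- edges are oriented.
      walk-to : ∀ u → Acc _<_ (ρ u) → Star Oriented u c
      walk-to u (acc rec) with step u
      ... | inj₁ usu∈         = cyclicPairs-connected Sum.swap (inj₁ ∘ successor-on-cycle) (∈-cyclicPairs⇒∈ˡ usu∈) c∈
      ... | inj₂ (_ , closer) = inj₁ refl ◅ walk-to (s u) (rec closer)

      oriented-connected : ∀ u v → Star Oriented u v
      oriented-connected u v = walk-to u (<-wellFounded _) ◅◅ Star.reverse Sum.swap (walk-to v (<-wellFounded _))

    -- Otherwise uv closes an oriented path to a cycle, which is C, so uv was oriented after all.
    adjacent⇒oriented : ∀ {u v} → u ~ v → Oriented u v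
    adjacent⇒oriented {u} {v} u~v with oriented? u v
    ... | yes uv = uv
    ... | no ¬uv with simplePath Fin._≟_ (oriented-connected (proj₂ (nonempty long)) u v)
    -- A path without edges would make `u` a neighbour of itself, and a single edge would be an
    -- orientation of `uv`; any longer path has the three vertices that a cycle needs.
    ...   | []             , []           , _ = contradiction u~v (irrefl refl)
    ...   | _ ∷ []         , uv ∷ []      , _ = contradiction uv ¬uv
    ...   | vs@(_ ∷ _ ∷ _) , path , distinct′ =
      [ inj₂ ∘ successor-on-cycle , inj₁ ∘ successor-on-cycle ]′
        (Equivalence.from (unique D v u) (inj₁ (pairs-last path)))
      where
      D : Cycle G
      D = record
        { vertices = u ∷ vs
        ; long     = s≤s (s≤s (s≤s z≤n))
        ; distinct = distinct′
        ; closed   = All-pairs oriented⇒adjacent path (symmetric u~v)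
        }

    -- On the cycle this is its length being at least 3, off the cycle `ρ` would decrease twice and
    -- return; `s` never leaves the cycle, so no mixed case survives.
    no-2-cycle : ∀ u → s (s u) ≢ u
    no-2-cycle u ssu≡u with step u | step (s u)
    ... | inj₁ usu∈     | inj₁ susu∈     = cyclicPairs-asymmetric distinct long usu∈
                                             (subst (λ v → (s u , v) ∈ cyclicPairs vertices) ssu≡u susu∈)
    ... | inj₁ usu∈     | inj₂ (su∉ , _) = su∉ (∈-cyclicPairs⇒∈ʳ usu∈)
    ... | inj₂ (u∉ , _) | inj₁ susu∈     = u∉ (subst (_∈ vertices) ssu≡u (∈-cyclicPairs⇒∈ʳ susu∈))
    ... | inj₂ (_ , ρ<) | inj₂ (_ , ρ<′) = <-asym ρ< (subst (λ v → ρ v < ρ (s u)) ssu≡u ρ<′)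

    orientation : Orientation G s
    orientation = record
      { successor-adjacent = adjacent
      ; adjacent-oriented  = adjacent⇒oriented
      ; antisymmetric      = no-2-cycle
      }

  unicyclic⇒orientation : ∃[ s ] Orientation G s
  unicyclic⇒orientation with descent-to G (λ u → member? Fin._≟_ u vertices) (nonempty long)
  ... | ρ , closer = _ , TowardsCycle.orientation (proj₁ ∘ step) ρ (proj₁ ∘ proj₂ ∘ step) (proj₂ ∘ proj₂ ∘ step)
    where
    step : ∀ u → ∃[ v ] u ~ v × ((u , v) ∈ cyclicPairs vertices ⊎ (u ∉ vertices × ρ v < ρ u))
    step u with member? Fin._≟_ u vertices
    ... | yes u∈ = let v , uv∈ = ∈-next u∈ in v , All.lookup closed uv∈ , inj₁ uv∈
    ... | no  u∉ = let v , u~v , ρ< = closer u u∉ in v , u~v , inj₂ (u∉ , ρ<)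

-- Cycles with pendant vertices

module Concat (m n : ℕ) where

  ↑-cases : (P : Fin (m + n) → Set) → (∀ i → P (i ↑ˡ n)) → (∀ j → P (m ↑ʳ j)) → ∀ u → P u
  ↑-cases P Pˡ Pʳ u = subst P (Fin.join-splitAt m n u) (go (splitAt m u))
    where
    go : ∀ v → P (join m n v)
    go (inj₁ i) = Pˡ i
    go (inj₂ j) = Pʳ j

  ↑ˡ≢↑ʳ : ∀ {i j} → i ↑ˡ n ≢ m ↑ʳ j
  ↑ˡ≢↑ʳ {i} {j} eq with trans (sym (Fin.splitAt-↑ˡ m i n)) (trans (cong (splitAt m) eq) (Fin.splitAt-↑ʳ m n j))
  ... | ()

-- The projection to `Fin k` from the disjoint union of the `Fin (a i)`, flattened into consecutive
-- blocks.
attach : ∀ {k} (a : Fin k → ℕ) → Fin (Σⁿ.sum a) → Fin k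
attach {suc k} a j = [ const zero , suc ∘ attach (a ∘ suc) ]′ (splitAt (a zero) j)

attach-fibre : ∀ {k} (a : Fin k → ℕ) i → Σⁿ.sum (λ j → ⟦ attach a j Fin.≟ i ⟧) ≡ a i
attach-fibre {suc k} a i = begin
  Σⁿ.sum (λ j → ⟦ attach a j Fin.≟ i ⟧)
    ≡⟨ sum-splitAt +-0-commutativeMonoid (a zero) (λ j → ⟦ attach a j Fin.≟ i ⟧) ⟩
  Σⁿ.sum (λ j → ⟦ attach a (j ↑ˡ rest) Fin.≟ i ⟧) + Σⁿ.sum (λ j → ⟦ attach a (a zero ↑ʳ j) Fin.≟ i ⟧)
    ≡⟨ cong₂ _+_
         (Σⁿ.sum-cong-≗ (λ j → cong (λ v → ⟦ [ const zero , suc ∘ attach (a ∘ suc) ]′ v Fin.≟ i ⟧) (Fin.splitAt-↑ˡ (a zero) j rest)))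
         (Σⁿ.sum-cong-≗ (λ j → cong (λ v → ⟦ [ const zero , suc ∘ attach (a ∘ suc) ]′ v Fin.≟ i ⟧) (Fin.splitAt-↑ʳ (a zero) rest j))) ⟩
  Σⁿ.sum {a zero} (λ j → ⟦ zero Fin.≟ i ⟧) + Σⁿ.sum (λ j → ⟦ suc (attach (a ∘ suc) j) Fin.≟ i ⟧)
    ≡⟨ count i ⟩
  a i ∎
  where
  open ≡-Reasoning
  rest = Σⁿ.sum (a ∘ suc)
  count : ∀ i → Σⁿ.sum {a zero} (λ j → ⟦ zero Fin.≟ i ⟧) + Σⁿ.sum (λ j → ⟦ suc (attach (a ∘ suc) j) Fin.≟ i ⟧) ≡ a i
  count zero    = trans (cong₂ _+_ (Σ-const-1 (a zero)) (Σⁿ.sum-replicate-zero rest)) (+-identityʳ (a zero))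
  count (suc i) = cong₂ _+_ (Σⁿ.sum-replicate-zero (a zero)) (attach-fibre (a ∘ suc) i)

All-pairs-tabulate : ∀ {A : Set} {R : Rel A 0ℓ} {l w} (g : Fin (suc l) → A) →
  (∀ i → R (g (inject₁ i)) (g (suc i))) → R (g (lastFin l)) w →
  All (uncurry R) (pairs (g zero) (tabulate (g ∘ suc)) w)
All-pairs-tabulate {l = zero}  g Rg Rw = Rw ∷ []
All-pairs-tabulate {l = suc l} g Rg Rw = Rg zero ∷ All-pairs-tabulate (g ∘ suc) (Rg ∘ suc) Rw

-- The cyclic shift by -1. Going down sends `suc i` to `inject₁ i`, the shape in which the weak
-- inductions on `Fin` and `sum-init-last` are stated.
rotate : ∀ {l} → Fin (suc l) → Fin (suc l)
rotate zero    = lastFin _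
rotate (suc i) = inject₁ i

rotate-injective : ∀ {l} {i j : Fin (suc l)} → rotate i ≡ rotate j → i ≡ j
rotate-injective {i = zero}  {zero}  _  = refl
rotate-injective {i = zero}  {suc j} eq = contradiction eq Fin.fromℕ≢inject₁
rotate-injective {i = suc i} {zero}  eq = contradiction (sym eq) Fin.fromℕ≢inject₁
rotate-injective {i = suc i} {suc j} eq = cong suc (Fin.inject₁-injective eq)

rotate-fibre : ∀ {l} (j : Fin (suc l)) → Σⁿ.sum (λ i → ⟦ rotate i Fin.≟ j ⟧) ≡ 1
rotate-fibre {l} j = begin
  ⟦ lastFin l Fin.≟ j ⟧ + Σⁿ.sum (λ i → ⟦ inject₁ i Fin.≟ j ⟧)  ≡⟨ +-comm ⟦ lastFin l Fin.≟ j ⟧ _ ⟩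
  Σⁿ.sum (λ i → ⟦ inject₁ i Fin.≟ j ⟧) + ⟦ lastFin l Fin.≟ j ⟧  ≡⟨ Σⁿ.sum-init-last (λ i → ⟦ i Fin.≟ j ⟧) ⟨
  Σⁿ.sum (λ i → ⟦ i Fin.≟ j ⟧)                                  ≡⟨ Σⁿ.sum-cong-≗ (λ i → ⟦⟧-cong (i Fin.≟ j) (j Fin.≟ i) sym sym) ⟩
  Σⁿ.sum (λ i → ⟦ j Fin.≟ i ⟧)                                  ≡⟨ Σ-⟦≟⟧ j ⟩
  1                                                             ∎
  where open ≡-Reasoning

rotate≢ : ∀ {l} (i : Fin (2 + l)) → rotate i ≢ i
rotate≢ (suc i) eq = m≢1+m+n (toℕ i) (trans (trans (sym (Fin.toℕ-inject₁ i)) (cong toℕ eq)) (cong suc (sym (+-identityʳ (toℕ i)))))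

-- At 0 and 1, where the shift wraps around, the two sides have clashing constructors. This is where
-- length 3 matters: on two vertices the double shift is the identity.
rotate²≢ : ∀ {l} (i : Fin (3 + l)) → rotate (rotate i) ≢ i
rotate²≢ (suc (suc i)) eq = m≢1+m+n (toℕ i) (begin
  toℕ i                        ≡⟨ Fin.toℕ-inject₁ i ⟨
  toℕ (inject₁ i)              ≡⟨ Fin.toℕ-inject₁ (inject₁ i) ⟨
  toℕ (inject₁ (inject₁ i))    ≡⟨ cong toℕ eq ⟩
  2 + toℕ i                    ≡⟨ cong suc (+-comm (toℕ i) 1) ⟨
  suc (toℕ i + 1)              ∎)
  where open ≡-Reasoning

-- A cycle of length 3 + l, traversed downwards, with a i pendant vertices attached to its vertex i.
module Sun {l} (a : Fin (3 + l) → ℕ) where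
  private
    k = 3 + l
    p = Σⁿ.sum a

  open Concat k p

  rim : Fin k → Fin (k + p)
  rim i = i ↑ˡ p

  leaf : Fin p → Fin (k + p)
  leaf j = k ↑ʳ j

  -- `rim` stands outside the case split, so every value of `s` is visibly a rim vertex and no leaf
  -- is a successor.
  s : Fin (k + p) → Fin (k + p)
  s u = rim ([ rotate , attach a ]′ (splitAt k u))

  s-rim : ∀ i → s (rim i) ≡ rim (rotate i)
  s-rim i = cong (rim ∘ [ rotate , attach a ]′) (Fin.splitAt-↑ˡ k i p)

  s-leaf : ∀ j → s (leaf j) ≡ rim (attach a j)
  s-leaf j = cong (rim ∘ [ rotate , attach a ]′) (Fin.splitAt-↑ʳ k p j)

  rim-injective : ∀ {i j} → rim i ≡ rim j → i ≡ j
  rim-injective = Fin.↑ˡ-injective p _ _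

  s≢ : ∀ u → s u ≢ u
  s≢ = ↑-cases _ (λ i eq → rotate≢ i (rim-injective (trans (sym (s-rim i)) eq))) (λ j → ↑ˡ≢↑ʳ)

  s²≢ : ∀ u → s (s u) ≢ u
  s²≢ = ↑-cases _
    (λ i eq → rotate²≢ i (rim-injective (trans (sym (trans (cong s (s-rim i)) (s-rim (rotate i)))) eq)))
    (λ j → ↑ˡ≢↑ʳ)

  -- Adjacency is generated by `s`, so the graph comes with its orientation and the degree formulas
  -- for oriented graphs apply to it directly.
  _~_ : Rel (Fin (k + p)) 0ℓ
  u ~ v = s u ≡ v ⊎ s v ≡ u

  s-edge : ∀ {u v} → s u ≡ v → Star _~_ u v
  s-edge su≡v = inj₁ su≡v ◅ ε

  walk-to-0 : ∀ u → Star _~_ u (rim zero)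
  walk-to-0 = ↑-cases _ from-rim (λ j → s-edge (s-leaf j) ◅◅ from-rim (attach a j))
    where
    from-rim : ∀ i → Star _~_ (rim i) (rim zero)
    from-rim = <-weakInduction _ ε (λ i walk → s-edge (s-rim (suc i)) ◅◅ walk)

  G : Graph (k + p)
  G = record
    { _~_       = _~_
    ; _~?_      = λ u v → (s u Fin.≟ v) ⊎-dec (s v Fin.≟ u)
    ; irrefl    = λ { refl → [ s≢ _ , s≢ _ ]′ }
    ; symmetric = Sum.swap
    ; connected = λ u v → walk-to-0 u ◅◅ Star.reverse Sum.swap (walk-to-0 v)
    ; hasEdge   = rim zero , _ , inj₁ refl
    }

  orientation : Orientation G s
  orientation = record
    { successor-adjacent = λ _ → inj₁ refl
    ; adjacent-oriented  = λ u~v → u~v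
    ; antisymmetric      = s²≢
    }

  open Orientation orientation using (fibre)

  private
    fibre-split : ∀ u → fibre u ≡ Σⁿ.sum (λ i → ⟦ rim (rotate i) Fin.≟ u ⟧) + Σⁿ.sum (λ j → ⟦ rim (attach a j) Fin.≟ u ⟧)
    fibre-split u = trans (sum-splitAt +-0-commutativeMonoid k (λ v → ⟦ s v Fin.≟ u ⟧)) (cong₂ _+_
      (Σⁿ.sum-cong-≗ (λ i → cong (λ v → ⟦ v Fin.≟ u ⟧) (s-rim i)))
      (Σⁿ.sum-cong-≗ (λ j → cong (λ v → ⟦ v Fin.≟ u ⟧) (s-leaf j))))

    ⟦rim≟rim⟧ : ∀ i j → ⟦ rim i Fin.≟ rim j ⟧ ≡ ⟦ i Fin.≟ j ⟧
    ⟦rim≟rim⟧ i j = ⟦⟧-cong (rim i Fin.≟ rim j) (i Fin.≟ j) rim-injective (cong rim)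

    ⟦rim≟leaf⟧ : ∀ i j → ⟦ rim i Fin.≟ leaf j ⟧ ≡ 0
    ⟦rim≟leaf⟧ i j = ⟦⟧-no (rim i Fin.≟ leaf j) ↑ˡ≢↑ʳ

  fibre-rim : ∀ i → fibre (rim i) ≡ suc (a i)
  fibre-rim i = trans (fibre-split (rim i)) (cong₂ _+_
    (trans (Σⁿ.sum-cong-≗ (λ j → ⟦rim≟rim⟧ (rotate j) i)) (rotate-fibre i))
    (trans (Σⁿ.sum-cong-≗ (λ j → ⟦rim≟rim⟧ (attach a j) i)) (attach-fibre a i)))

  fibre-leaf : ∀ j → fibre (leaf j) ≡ 0
  fibre-leaf j = trans (fibre-split (leaf j)) (cong₂ _+_
    (trans (Σⁿ.sum-cong-≗ (λ i → ⟦rim≟leaf⟧ (rotate i) j)) (Σⁿ.sum-replicate-zero k))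
    (trans (Σⁿ.sum-cong-≗ (λ i → ⟦rim≟leaf⟧ (attach a i) j)) (Σⁿ.sum-replicate-zero p)))

  Σ-isZero-fibre : Σⁿ.sum (isZero ∘ fibre) ≡ p
  Σ-isZero-fibre = trans (sum-splitAt +-0-commutativeMonoid k (isZero ∘ fibre)) (cong₂ _+_
    (trans (Σⁿ.sum-cong-≗ (λ i → cong isZero (fibre-rim i))) (Σⁿ.sum-replicate-zero k))
    (trans (Σⁿ.sum-cong-≗ (λ j → cong isZero (fibre-leaf j))) (Σ-const-1 p)))

  Σʳ-fibre : ∀ (h : ℕ → ℝ) → Σʳ.sum (h ∘ fibre) ≐ Σʳ.sum (h ∘ suc ∘ a) +ʳ fromℕ p *ʳ h 0
  Σʳ-fibre h n = trans (sum-splitAt ℝ-+-commutativeMonoid k (h ∘ fibre) n) (cong₂ ℚ._+_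
    (cong (λ x → seq x n) (Σʳ.sum-cong-≗ (λ i → cong h (fibre-rim i))))
    (trans (cong (λ x → seq x n) (Σʳ.sum-cong-≗ (λ j → cong h (fibre-leaf j)))) (Σʳ-const p (h 0) n)))

  rimCycle : Cycle G
  rimCycle = record
    { vertices = tabulate rim
    ; long     = subst (3 ≤_) (sym (length-tabulate rim)) (s≤s (s≤s (s≤s z≤n)))
    ; distinct = tabulate⁺ rim-injective
    ; closed   = All-pairs-tabulate rim (λ i → inj₂ (s-rim (suc i))) (inj₂ (s-rim zero))
    }

  -- A description of edges that mentions no cycle: each cycle is shown to traverse exactly these,
  -- so any two have the same edges.
  RimEdge : Rel (Fin (k + p)) 0ℓ
  RimEdge u v = ∃[ i ] u ≡ rim i × v ≡ rim (rotate i)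

  -- Every cycle runs along the rim

  module _ (D : Cycle G) where
    open Cycle D

    private
      adjacent : ∀ {u v} → (u , v) ∈ cyclicPairs vertices → u ~ v
      adjacent = All.lookup closed

      asymmetric : ∀ {u v} → (u , v) ∈ cyclicPairs vertices → ¬ (v , u) ∈ cyclicPairs vertices
      asymmetric = cyclicPairs-asymmetric distinct long

    -- The vertices before and after a leaf would both be its only neighbour, so one edge would be
    -- traversed in both directions.
    leaf∉ : ∀ j → leaf j ∉ vertices
    leaf∉ j j∈ with ∈-previous j∈ | ∈-next j∈
    ... | u , uj∈ | v , jv∈ with adjacent uj∈ | adjacent jv∈
    ...   | inj₁ su≡j | _         = ↑ˡ≢↑ʳ su≡j
    ...   | inj₂ _    | inj₂ sv≡j = ↑ˡ≢↑ʳ sv≡j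
    ...   | inj₂ refl | inj₁ refl = asymmetric uj∈ jv∈

    ∈⇒rim : ∀ u → u ∈ vertices → ∃[ i ] u ≡ rim i
    ∈⇒rim = ↑-cases _ (λ i _ → i , refl) (λ j j∈ → contradiction j∈ (leaf∉ j))

    -- The two neighbours of a rim vertex on the cycle are distinct rim
    -- vertices, and at most one of them can be its predecessor.
    traverses-successor : ∀ {i} → rim i ∈ vertices → Cycle.Traverses D (rim i) (rim (rotate i))
    traverses-successor {i} i∈ with ∈-previous i∈ | ∈-next i∈
    ... | u , ui∈ | v , iv∈
      with ∈⇒rim u (∈-cyclicPairs⇒∈ˡ ui∈) | ∈⇒rim v (∈-cyclicPairs⇒∈ʳ iv∈) | adjacent ui∈ | adjacent iv∈
    ... | _ , refl | _ , refl | inj₂ si≡u | _ = inj₂ (subst (λ w → (w , rim i) ∈ cyclicPairs vertices) (trans (sym si≡u) (s-rim i)) ui∈)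
    ... | _ , refl | _ , refl | inj₁ _    | inj₁ si≡v = inj₁ (subst (λ w → (rim i , w) ∈ cyclicPairs vertices) (trans (sym si≡v) (s-rim i)) iv∈)
    ... | u , refl | v , refl | inj₁ su≡i | inj₂ sv≡i = contradiction iv∈ (asymmetric (subst (λ w → (rim w , rim i) ∈ cyclicPairs vertices) u≡v ui∈))
      where
      u≡v : u ≡ v
      u≡v = rotate-injective (rim-injective (trans (sym (s-rim u)) (trans su≡i (trans (sym sv≡i) (s-rim v)))))

    rotate-∈ : ∀ i → rim i ∈ vertices → rim (rotate i) ∈ vertices
    rotate-∈ i i∈ = [ ∈-cyclicPairs⇒∈ʳ , ∈-cyclicPairs⇒∈ˡ ]′ (traverses-successor i∈)

    -- Membership passes from each rim vertex to the one below: from some vertex of `D` down to 0,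
    -- then around to the last and down through all of them.
    rim∈ : ∀ i → rim i ∈ vertices
    rim∈ = >-weakInduction (λ i → rim i ∈ vertices) (rotate-∈ zero zero∈) (λ i → rotate-∈ (suc i))
      where
      zero∈ : rim zero ∈ vertices
      zero∈ with nonempty long
      ... | u , u∈ with ∈⇒rim u u∈
      ...   | i , refl = <-weakInduction (λ i → rim i ∈ vertices → rim zero ∈ vertices)
                           (λ 0∈ → 0∈) (λ i ⇒0∈ i∈ → ⇒0∈ (rotate-∈ (suc i) i∈)) i u∈

    traverses⇒rimEdge : ∀ {u v} → Cycle.Traverses D u v → RimEdge u v ⊎ RimEdge v u
    traverses⇒rimEdge = [ pair , Sum.swap ∘ pair ]′
      where
      pair : ∀ {u v} → (u , v) ∈ cyclicPairs vertices → RimEdge u v ⊎ RimEdge v u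
      pair uv∈ with ∈⇒rim _ (∈-cyclicPairs⇒∈ˡ uv∈) | ∈⇒rim _ (∈-cyclicPairs⇒∈ʳ uv∈) | adjacent uv∈
      ... | i , refl | j , refl | inj₁ su≡v = inj₁ (i , refl , trans (sym su≡v) (s-rim i))
      ... | i , refl | j , refl | inj₂ sv≡u = inj₂ (j , refl , trans (sym sv≡u) (s-rim j))

    rimEdge⇒traverses : ∀ {u v} → RimEdge u v ⊎ RimEdge v u → Cycle.Traverses D u v
    rimEdge⇒traverses (inj₁ (i , refl , refl)) = traverses-successor (rim∈ i)
    rimEdge⇒traverses (inj₂ (i , refl , refl)) = Sum.swap (traverses-successor (rim∈ i))

  unicyclic : Unicyclic G
  unicyclic = rimCycle , λ D u v → mk⇔
    (rimEdge⇒traverses D ∘ traverses⇒rimEdge rimCycle)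
    (rimEdge⇒traverses rimCycle ∘ traverses⇒rimEdge D)

-- Concave functions and degree sums

fromℚ-mono-≤ : ∀ {p q} → p ℚ.≤ q → fromℚ p ≤ʳ fromℚ q
fromℚ-mono-≤ {p} {q} p≤q e 0<e = 0 , λ _ _ → begin
  p              ≤⟨ p≤q ⟩
  q              ≡⟨ ℚ.+-identityʳ q ⟨
  q ℚ.+ ℚ.0ℚ     ≤⟨ ℚ.+-monoʳ-≤ q (ℚ.<⇒≤ 0<e) ⟩
  q ℚ.+ e        ∎
  where open ℚ.≤-Reasoning

2≤fromℕ : ∀ k → fromℕ 2 ≤ʳ fromℕ (2 + k)
2≤fromℕ k = fromℚ-mono-≤ (begin
  ℤ.+ 2 ℚ./ 1                          ≡⟨ ℚ.+-identityʳ (ℤ.+ 2 ℚ./ 1) ⟨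
  (ℤ.+ 2 ℚ./ 1) ℚ.+ ℚ.0ℚ               ≤⟨ ℚ.+-monoʳ-≤ (ℤ.+ 2 ℚ./ 1) (ℚ.nonNegative⁻¹ (ℤ.+ k ℚ./ 1) {{ℚ.normalize-nonNeg k 1}}) ⟩
  (ℤ.+ 2 ℚ./ 1) ℚ.+ (ℤ.+ k ℚ./ 1)        ≡⟨ fromℕ-+ 2 k ⟨
  ℤ.+ (2 + k) ℚ./ 1                    ∎)
  where open ℚ.≤-Reasoning

module _ (f : [1,∞⟩⟶ℝ) where

  -- The argument is the degree minus one, which is the size of a fibre.
  at-suc : ℕ → ℝ
  at-suc k = f at suc k

  private
    h = at-suc

  -- Concavity with s = 1/2 at the endpoints k + 2 and k + 4, added to itself to clear the halves.
  concave-at : ConcaveOn[2,∞⟩ f → Concave (h ∘ suc)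
  concave-at concave k =
    ≤ʳ-by-≐ {½x+½y +ʳ ½x+½y} {y +ʳ y} {x +ʳ z} {y +ʳ y}
      (+ʳ-mono-≤ʳ {½x+½y} {y} {½x+½y} {y} midpoint midpoint)
      λ n → cong (ℚ._+ (seq y n ℚ.+ seq y n)) (doubled (seq x n) (seq z n))
    where
    x = f at (2 + k)
    y = f at (3 + k)
    z = f at (4 + k)
    ½ʳ = fromℚ ℚ.½
    ½x+½y = ½ʳ *ʳ x +ʳ (1ℝ -ʳ ½ʳ) *ʳ z
    doubled : ∀ a b → a ℚ.+ b ≡ (ℚ.½ ℚ.* a ℚ.+ (ℚ.1ℚ ℚ.- ℚ.½) ℚ.* b) ℚ.+ (ℚ.½ ℚ.* a ℚ.+ (ℚ.1ℚ ℚ.- ℚ.½) ℚ.* b)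
    doubled = solve 2 (λ a b → a :+ b := (con ℚ.½ :* a :+ con (ℚ.1ℚ ℚ.- ℚ.½) :* b) :+ (con ℚ.½ :* a :+ con (ℚ.1ℚ ℚ.- ℚ.½) :* b)) refl
      where open +-*-Solver
    average : ∀ a → (ℚ.1ℚ ℚ.+ a) ≡ ℚ.½ ℚ.* a ℚ.+ (ℚ.1ℚ ℚ.- ℚ.½) ℚ.* ((ℤ.+ 2 ℚ./ 1) ℚ.+ a)
    average = solve 1 (λ a → con ℚ.1ℚ :+ a := con ℚ.½ :* a :+ con (ℚ.1ℚ ℚ.- ℚ.½) :* (con (ℤ.+ 2 ℚ./ 1) :+ a)) refl
      where open +-*-Solver
    midpoint : ½x+½y ≤ʳ y
    midpoint = concave (fromℕ (2 + k) , 1≤fromℕ (2 + k)) (fromℕ (4 + k) , 1≤fromℕ (4 + k)) (fromℕ (3 + k) , 1≤fromℕ (3 + k)) ½ʳ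
      (2≤fromℕ k) (2≤fromℕ (2 + k)) (fromℚ-mono-≤ (ℚ.nonNegative⁻¹ ℚ.½)) (fromℚ-mono-≤ ½≤1)
      (≐⇒≃ {fromℕ (3 + k)} {½ʳ *ʳ fromℕ (2 + k) +ʳ (1ℝ -ʳ ½ʳ) *ʳ fromℕ (4 + k)}
        λ _ → trans (fromℕ-+ 1 (2 + k)) (trans (average (ℤ.+ (2 + k) ℚ./ 1))
          (cong (λ c → ℚ.½ ℚ.* (ℤ.+ (2 + k) ℚ./ 1) ℚ.+ (ℚ.1ℚ ℚ.- ℚ.½) ℚ.* c) (sym (fromℕ-+ 2 (2 + k))))))
      where
      ½≤1 : ℚ.½ ℚ.≤ ℚ.1ℚ
      ½≤1 = ℚ.*≤* (ℤ.+≤+ (s≤s z≤n))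

  -- `I` unfolds to the same fold as `Σʳ.sum`, and the `NonZero` argument of `_at_` is irrelevant,
  -- so rewriting the degrees gives propositional equality.
  I-fibres : ∀ {n} {G : Graph n} {s} (o : Orientation G s) → I G f ≡ Σʳ.sum (h ∘ Orientation.fibre o)
  I-fibres {G = G} o = Σʳ.sum-cong-≗ λ u → at-cong (Orientation.degree≡1+fibre o u) {{Graph.degree-nonZero G u}}
    where
    at-cong : ∀ {d x} → d ≡ suc x → .{{_ : NonZero d}} → f at d ≡ h x
    at-cong refl = refl

  -- `n` and `k` are independent variables here so that `n ≡ k + p` can be matched with `refl`; with
  -- k = n ∸ p substituted, `n` would occur on both sides.
  I-lower-bound : ConcaveOn[2,∞⟩ f → ∀ {n k p} → n ≡ k + p → 1 ≤ k →
    (G : Graph n) → Unicyclic G → Graph.pendantCount G ≡ p →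
    f at (2 + p) +ʳ fromℕ (k ∸ 1) *ʳ f at 2 +ʳ fromℕ p *ʳ f at 1 ≤ʳ I G f
  I-lower-bound concave {k = k} {p} refl 1≤k G (C , unique) pendants =
    let s , o = unicyclic⇒orientation C unique in
    subst (f at (2 + p) +ʳ fromℕ (k ∸ 1) *ʳ f at 2 +ʳ fromℕ p *ʳ f at 1 ≤ʳ_) (sym (I-fibres o))
    (Bounds.lower-bound h (concave-at concave) (Orientation.fibre o) (Orientation.Σ-fibre o)
      (trans (sym (Orientation.pendantCount≡ o)) pendants) 1≤k)

  I-upper-bound : ConcaveOn[2,∞⟩ f → ∀ {n k p m m′ t} .{{_ : NonZero m}} → n ≡ k + p → m ≡ 2 + m′ → t ≤ k → p ≡ t + m′ * k →
    (G : Graph n) → Unicyclic G → Graph.pendantCount G ≡ p →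
    I G f ≤ʳ fromℕ t *ʳ f at (1 + m) +ʳ fromℕ (k ∸ t) *ʳ f at m +ʳ fromℕ p *ʳ f at 1
  I-upper-bound concave {k = k} {p} {m} {m′} {t} refl refl t≤k p≡t+m′k G (C , unique) pendants =
    let s , o = unicyclic⇒orientation C unique in
    subst (_≤ʳ fromℕ t *ʳ f at (1 + m) +ʳ fromℕ (k ∸ t) *ʳ f at m +ʳ fromℕ p *ʳ f at 1) (sym (I-fibres o))
    (Bounds.upper-bound h (concave-at concave) (Orientation.fibre o) (Orientation.Σ-fibre o)
      (trans (sym (Orientation.pendantCount≡ o)) pendants) m′ t t≤k p≡t+m′k)

  -- Every distribution `a` of the excess p over k ≥ 3 vertices is realised, so attaining a bound
  -- reduces to choosing `a`.
  sun-exists : ∀ {n k p} (a : Fin k → ℕ) → 3 ≤ k → Σⁿ.sum a ≡ p → n ≡ k + p →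
    ∃[ G ] Unicyclic {n} G × Graph.pendantCount G ≡ p × I G f ≐ Σʳ.sum (h ∘ suc ∘ a) +ʳ fromℕ p *ʳ h 0
  sun-exists a (s≤s (s≤s (s≤s z≤n))) refl refl =
    G , unicyclic , trans (Orientation.pendantCount≡ orientation) Σ-isZero-fibre ,
    λ n → trans (cong (λ x → seq x n) (I-fibres orientation)) (Σʳ-fibre h n)
    where open Sun a

  lower-attained : ∀ {n k p} → n ≡ k + p → 3 ≤ k →
    ∃[ G ] Unicyclic {n} G × Graph.pendantCount G ≡ p ×
      I G f ≃ f at (2 + p) +ʳ fromℕ (k ∸ 1) *ʳ f at 2 +ʳ fromℕ p *ʳ f at 1
  lower-attained {k = suc k} {p} n≡k+p 3≤k =
    let G , unicyclic , pendants , I≐ = sun-exists a 3≤k Σa≡p n≡k+p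
    in G , unicyclic , pendants , ≐⇒≃ {I G f} {f at (2 + p) +ʳ fromℕ k *ʳ f at 2 +ʳ fromℕ p *ʳ f at 1} λ n → trans (I≐ n)
      (cong (λ x → seq (f at (2 + p)) n ℚ.+ x ℚ.+ (ℤ.+ p ℚ./ 1) ℚ.* seq (f at 1) n) (Σʳ-const k (f at 2) n))
    where
    a : Fin (suc k) → ℕ
    a zero    = p
    a (suc _) = 0
    Σa≡p : Σⁿ.sum a ≡ p
    Σa≡p = trans (cong (p +_) (Σⁿ.sum-replicate-zero k)) (+-identityʳ p)

  upper-attained : ∀ {n k p m m′ t} .{{_ : NonZero m}} → n ≡ k + p → 3 ≤ k → m ≡ 2 + m′ → t ≤ k → p ≡ t + m′ * k →
    ∃[ G ] Unicyclic {n} G × Graph.pendantCount G ≡ p ×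
      I G f ≃ fromℕ t *ʳ f at (1 + m) +ʳ fromℕ (k ∸ t) *ʳ f at m +ʳ fromℕ p *ʳ f at 1
  upper-attained {n} {k} {p} {m} {m′} {t} n≡k+p 3≤k refl t≤k p≡t+m′k =
    let G , unicyclic , pendants , I≐ = sun-exists a (subst (3 ≤_) (sym t+r≡k) 3≤k) Σa≡p (trans n≡k+p (cong (_+ p) (sym t+r≡k)))
    in G , unicyclic , pendants , ≐⇒≃ {I G f} {fromℕ t *ʳ f at (1 + m) +ʳ fromℕ r *ʳ f at m +ʳ fromℕ p *ʳ f at 1} λ n →
      trans (I≐ n) (cong (ℚ._+ (ℤ.+ p ℚ./ 1) ℚ.* seq (f at 1) n) (Σga n))
    where
    r = k ∸ t
    t+r≡k : t + r ≡ k
    t+r≡k = m+[n∸m]≡n t≤k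
    a : Fin (t + r) → ℕ
    -- The most even distribution of p = t + m′k. The cycle is indexed by `t + r` instead of `k` so
    -- that `splitAt` separates the two values.
    a u = [ const (suc m′) , const m′ ]′ (splitAt t u)
    a-splits : ∀ {A : Set} (φ : ℕ → A) → (∀ i → φ (a (i ↑ˡ r)) ≡ φ (suc m′)) × (∀ j → φ (a (t ↑ʳ j)) ≡ φ m′)
    a-splits φ = (λ i → cong (φ ∘ [ const (suc m′) , const m′ ]′) (Fin.splitAt-↑ˡ t i r)) ,
                 (λ j → cong (φ ∘ [ const (suc m′) , const m′ ]′) (Fin.splitAt-↑ʳ t r j))
    Σa≡p : Σⁿ.sum a ≡ p
    Σa≡p = begin
      Σⁿ.sum a                                                    ≡⟨ sum-splitAt +-0-commutativeMonoid t a ⟩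
      Σⁿ.sum (λ i → a (i ↑ˡ r)) + Σⁿ.sum (λ j → a (t ↑ʳ j))       ≡⟨ cong₂ _+_
                                                                       (trans (Σⁿ.sum-cong-≗ (proj₁ (a-splits λ c → c))) (Σ-const t (suc m′)))
                                                                       (trans (Σⁿ.sum-cong-≗ (proj₂ (a-splits λ c → c))) (Σ-const r m′)) ⟩
      t * suc m′ + r * m′                                         ≡⟨ cong (_+ r * m′) (*-suc t m′) ⟩
      t + t * m′ + r * m′                                         ≡⟨ +-assoc t (t * m′) (r * m′) ⟩
      t + (t * m′ + r * m′)                                       ≡⟨ cong (t +_) (*-distribʳ-+ m′ t r) ⟨
      t + (t + r) * m′                                            ≡⟨ cong (λ c → t + c * m′) t+r≡k ⟩
      t + k * m′                                                  ≡⟨ cong (t +_) (*-comm k m′) ⟩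
      t + m′ * k                                                  ≡⟨ p≡t+m′k ⟨
      p                                                           ∎
      where open ≡-Reasoning
    Σga : Σʳ.sum (h ∘ suc ∘ a) ≐ fromℕ t *ʳ f at (1 + m) +ʳ fromℕ r *ʳ f at m
    Σga n = trans (sum-splitAt ℝ-+-commutativeMonoid t (h ∘ suc ∘ a) n) (cong₂ ℚ._+_
      (trans (cong (λ x → seq x n) (Σʳ.sum-cong-≗ (proj₁ (a-splits (h ∘ suc))))) (Σʳ-const t (f at (1 + m)) n))
      (trans (cong (λ x → seq x n) (Σʳ.sum-cong-≗ (proj₂ (a-splits (h ∘ suc))))) (Σʳ-const r (f at m) n)))

theorem5p3 :
  ∀ (n p : ℕ) (4≤n : 4 ≤ n) (1≤p : 1 ≤ p) (p≤n∸3 : p ≤ n ∸ 3) →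
  let instance
        n∸p≢0 : NonZero (n ∸ p)
        n∸p≢0 = n∸p-nonZero 4≤n p≤n∸3
        m≢0 : NonZero ((2 * n ∸ p) / (n ∸ p))
        m≢0 = quotient-nonZero n p
      m = (2 * n ∸ p) / (n ∸ p)
      t = 2 * n ∸ p ∸ m * (n ∸ p)
  in
  ∀ (f : [1,∞⟩⟶ℝ) → ConcaveOn[2,∞⟩ f →
  let lower = f at (2 + p) +ʳ fromℕ (n ∸ p ∸ 1) *ʳ f at 2 +ʳ fromℕ p *ʳ f at 1
      upper = fromℕ t *ʳ f at (1 + m) +ʳ fromℕ (n ∸ p ∸ t) *ʳ f at m +ʳ fromℕ p *ʳ f at 1
  in
  (∀ (G : Graph n) → Unicyclic G → Graph.pendantCount G ≡ p →
    lower ≤ʳ I G f × I G f ≤ʳ upper)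
  × (∃[ G ] Unicyclic {n} G × Graph.pendantCount G ≡ p × I G f ≃ lower)
  × (∃[ G ] Unicyclic {n} G × Graph.pendantCount G ≡ p × I G f ≃ upper)
theorem5p3 n p 4≤n 1≤p p≤n∸3 f concave =
  (λ G unicyclic pendants →
    I-lower-bound f concave n≡k+p (≤-trans (s≤s z≤n) 3≤k) G unicyclic pendants ,
    I-upper-bound f concave n≡k+p m≡2+m′ t≤k p≡t+m′k G unicyclic pendants) ,
  lower-attained f n≡k+p 3≤k ,
  upper-attained f n≡k+p 3≤k m≡2+m′ t≤k p≡t+m′k
  where
  instance
    n∸p≢0 : NonZero (n ∸ p)
    n∸p≢0 = n∸p-nonZero 4≤n p≤n∸3
    m≢0 : NonZero ((2 * n ∸ p) / (n ∸ p))
    m≢0 = quotient-nonZero n p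
  k = n ∸ p
  m = (2 * n ∸ p) / k
  t = 2 * n ∸ p ∸ m * k
  m′ = m ∸ 2

  3≤n : 3 ≤ n
  3≤n = ≤-trans (n≤1+n 3) 4≤n

  p≤n : p ≤ n
  p≤n = ≤-trans p≤n∸3 (m∸n≤m n 3)

  n≡k+p : n ≡ k + p
  n≡k+p = sym (m∸n+n≡m p≤n)

  3≤k : 3 ≤ k
  3≤k = subst (_≤ k) (m∸[m∸n]≡n 3≤n) (∸-monoʳ-≤ n p≤n∸3)

  2n∸p≡2k+p : 2 * n ∸ p ≡ 2 * k + p
  2n∸p≡2k+p = begin
    2 * n ∸ p              ≡⟨ cong (λ c → 2 * c ∸ p) n≡k+p ⟩
    2 * (k + p) ∸ p        ≡⟨ cong (_∸ p) (*-distribˡ-+ 2 k p) ⟩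
    2 * k + 2 * p ∸ p      ≡⟨ +-∸-assoc (2 * k) (m≤m+n p (p + 0)) ⟩
    2 * k + (2 * p ∸ p)    ≡⟨ cong (2 * k +_) (trans (m+n∸m≡n p (p + 0)) (+-identityʳ p)) ⟩
    2 * k + p              ∎
    where open ≡-Reasoning

  -- The quotient of 2k + p by k is at least 2, so the truncated `m ∸ 2` is a true difference.
  m≡2+m′ : m ≡ 2 + m′
  m≡2+m′ = sym (m+[n∸m]≡n (begin
    2                      ≡⟨ m*n/n≡m 2 k ⟨
    2 * k / k              ≤⟨ /-monoˡ-≤ k (m≤m+n (2 * k) p) ⟩
    (2 * k + p) / k        ≡⟨ cong (_/ k) 2n∸p≡2k+p ⟨
    m                      ∎))
    where open ≤-Reasoning

  t≡remainder : (2 * n ∸ p) % k ≡ t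
  t≡remainder = m%n≡m∸m/n*n (2 * n ∸ p) k

  t≤k : t ≤ k
  t≤k = subst (_≤ k) t≡remainder (m%n≤n (2 * n ∸ p) k)

  -- Division with remainder of 2k + p by k, with 2k cancelled.
  p≡t+m′k : p ≡ t + m′ * k
  p≡t+m′k = +-cancelˡ-≡ (2 * k) _ _ (begin
    2 * k + p                    ≡⟨ 2n∸p≡2k+p ⟨
    2 * n ∸ p                    ≡⟨ m≡m%n+[m/n]*n (2 * n ∸ p) k ⟩
    (2 * n ∸ p) % k + m * k      ≡⟨ cong₂ (λ c d → c + d * k) t≡remainder m≡2+m′ ⟩
    t + (2 + m′) * k             ≡⟨ cong (t +_) (*-distribʳ-+ k 2 m′) ⟩
    t + (2 * k + m′ * k)         ≡⟨ +-assoc t (2 * k) (m′ * k) ⟨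
    t + 2 * k + m′ * k           ≡⟨ cong (_+ m′ * k) (+-comm t (2 * k)) ⟩
    2 * k + t + m′ * k           ≡⟨ +-assoc (2 * k) t (m′ * k) ⟩
    2 * k + (t + m′ * k)         ∎)
    where open ≡-Reasoning
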